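{- Let $q$ be a prime power and $d\geq 1$, and write $(q-1)d+1=q^a m$ where $a\geq 0$ is an integer and $m$ is a positive integer not divisible by $q$. Then the Hamming graph $H(q,d)$ has an efficient $(1,k)$-dominating function for every integer $k$ with $1\leq k\leq (q-1)d+1$ that is a multiple of $m$. Moreover, if $q$ is prime, then for an integer $1\leq k\leq (q-1)d+1$, $H(q,d)$ has an efficient $(1,k)$-dominating function if and only if $k$ is a multiple of $m$.
   Context: For a graph $X$ and vertex $v$, $N[v]$ denotes the closed neighbourhood of $v$ (the neighbours of $v$ together with $v$), and for $f:V(X)\to\mathbb{R}$ and $S\subseteq V(X)$, $f(S)=\sum_{u\in S}f(u)$. For nonnegative integers $j,k$, a $(j,k)$-dominating function on $X$ is a function $f:V(X)\to\{0,1,\ldots,j\}$ such that $f(N[v])\geq k$ for every vertex $v$; it is efficient if $f(N[v])=k$ for every vertex $v$. The Hamming graph $H(q,d)$ has as vertex set the $d$-tuples over a set of $q$ symbols (for $q$ a prime power, one may take $GF(q)^d$), two tuples being adjacent if and only if they differ in exactly one coordinate; it is $(q-1)d$-regular on $q^d$ vertices. -}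

module Defs where

open import Data.Nat using (ℕ; zero; suc; _+_; _*_; _^_; _≤_; _≤?_)
open import Data.Nat.Primality using (Prime)
open import Data.Fin using (Fin)
open import Data.Fin.Properties using () renaming (_≟_ to _≟ᶠ_)
open import Data.Vec using (Vec; []; _∷_)
open import Data.List using (List; []; _∷_; [_]; map; concatMap; allFin; filter)
open import Data.Nat.ListAction using (sum)
open import Data.Product using (Σ; _×_)
open import Relation.Nullary using (yes; no)
open import Relation.Binary.PropositionalEquality using (_≡_)

IsPrimePower : ℕ → Set
IsPrimePower q = Σ ℕ λ p → Σ ℕ λ e → Prime p × (1 ≤ e) × (q ≡ p ^ e)

Vertex : ℕ → ℕ → Set
Vertex q d = Vec (Fin q) d

allVertices : ∀ q d → List (Vertex q d)
allVertices q zero = [ [] ]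
allVertices q (suc d) = concatMap (λ x → map (x ∷_) (allVertices q d)) (allFin q)

hamming : ∀ {q d} → Vertex q d → Vertex q d → ℕ
hamming [] [] = 0
hamming (x ∷ u) (y ∷ v) with x ≟ᶠ y
... | yes _ = hamming u v
... | no _ = suc (hamming u v)

Adjacent : ∀ {q d} → Vertex q d → Vertex q d → Set
Adjacent u v = hamming u v ≡ 1

closedNbhd : ∀ q d → Vertex q d → List (Vertex q d)
closedNbhd q d v = filter (λ u → hamming u v ≤? 1) (allVertices q d)

sumClosedNbhd : ∀ q d → (Vertex q d → ℕ) → Vertex q d → ℕ
sumClosedNbhd q d f v = sum (map f (closedNbhd q d v))

IsDominating : ∀ q d → (j k : ℕ) → (Vertex q d → ℕ) → Set
IsDominating q d j k f = (∀ u → f u ≤ j) × (∀ v → k ≤ sumClosedNbhd q d f v)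

IsEfficientDominating : ∀ q d → (j k : ℕ) → (Vertex q d → ℕ) → Set
IsEfficientDominating q d j k f = (∀ u → f u ≤ j) × (∀ v → sumClosedNbhd q d f v ≡ k)

HasEfficientDominating : ∀ q d → (j k : ℕ) → Set
HasEfficientDominating q d j k = Σ (Vertex q d → ℕ) (IsEfficientDominating q d j k)

{-# OPTIONS --safe #-}

-- Existence.  Let 𝔽 be a field with q elements.  Take as columns h₁, …, h_d ∈ 𝔽^a one generator of each
-- line of 𝔽^a, each repeated m times, together with (m - 1)/(q - 1) zero columns.  Under the
-- syndrome map v ↦ Σ vᵢ hᵢ every closed neighbourhood of H(q,d) covers each element of 𝔽^a exactly
-- m times, so the preimage of any t elements of 𝔽^a is an efficient (1, t m)-dominating set.
--
-- Necessity.  Summing f(N[v]) = k over all v gives q^a m f(V) = k q^d; for q prime, m is coprime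
-- to q, hence m ∣ k.
--
-- The field.  Roots of monic polynomials are adjoined to ℤ/p without regard to irreducibility until
-- T^q - T splits.  In the resulting nonzero ring the differences of distinct roots are units, because
-- the derivative of T^q - T is -1, and sums and products of roots are again fixed by x ↦ x^q.  If
-- x^q = x then Π (x - αᵢ) = 0, so some αᵢ can be identified with x without collapsing the ring;
-- doing this for all sums and products of roots turns the q roots into a field.  Choosing αᵢ is not
-- effective, but the existence of a dominating function is decidable by finite search, so its double
-- negation suffices.
module Submission where

open import Defs
open import Algebra.Bundles using (CommutativeRing)
open import Algebra.Bundles.Raw using (RawRing)
open import Algebra.Morphism.Structures using (IsRingHomomorphism)
open import Algebra.Solver.Ring.AlmostCommutativeRing using (fromCommutativeRing; _-Raw-AlmostCommutative⟶_; Induced-equivalence)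
open import Data.Empty using (⊥-elim)
open import Data.Fin using (Fin; zero; suc; toℕ; fromℕ<; inject₁; punchIn; punchOut)
open import Data.Fin.Permutation using (permutation)
open import Data.Fin.Properties using (toℕ<n; toℕ-fromℕ; toℕ-fromℕ<; toℕ-inject₁; punchInᵢ≢i; punchOut-injective; injective⇒≤; any?) renaming (_≟_ to _≟ᶠ_)
open import Data.List using (List; []; _∷_; _++_; allFin; cartesianProductWith)
open import Data.List.Membership.Propositional using (_∈_)
open import Data.List.Membership.Propositional.Properties using (∈-allFin; ∈-++⁺ˡ; ∈-++⁺ʳ; ∈-cartesianProductWith⁺)
open import Data.List.Relation.Unary.Any using (Any; here; there)
open import Data.Maybe using (just; nothing)
open import Data.Nat using (ℕ; zero; suc; s≤s; z≤n)
open import Data.Nat.Combinatorics using (_C_; nCk+nC[k+1]≡[n+1]C[k+1]; nC1≡n; nCn≡1; k>n⇒nCk≡0)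
open import Data.Nat.Divisibility using (_∣_; divides; m∣m*n; ∣⇒≤; ∣-refl)
open import Data.Nat.Primality using (Prime; euclidsLemma; prime⇒irreducible; ¬prime[0]; ¬prime[1])
open import Data.Nat.Solver using (module +-*-Solver)
open import Data.Product using (_×_; _,_; Σ; ∃; proj₁; proj₂)
open import Data.Sum using (inj₁; inj₂)
open import Data.Vec using (Vec; []; _∷_; lookup; _∷ʳ_; head; zipWith)
open import Data.Vec.Functional using (Vector; tail; init; last)
open import Data.Vec.Properties using (lookup∘tabulate; zipWith-assoc; zipWith-comm; zipWith-identityˡ) renaming (map-∘ to Vec-map-∘)
open import Data.Vec.Relation.Binary.Pointwise.Inductive using (Pointwise; []; _∷_)
open import Function using (_∘_)
open import Level using (0ℓ)
open import Relation.Binary.Definitions using (WeaklyDecidable)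
open import Relation.Binary.PropositionalEquality using (_≡_; _≢_)
open import Relation.Nullary using (¬_; Dec; yes; no; does)
open import Relation.Nullary.Decidable using (decidable-stable; map′; ¬?)
import Algebra.Morphism.Construct.Composition as Composition
import Algebra.Morphism.Construct.Identity as Identity
import Algebra.Properties.AbelianGroup
import Algebra.Properties.CommutativeSemigroup
import Algebra.Properties.CommutativeSemiring.Binomial
import Algebra.Properties.CommutativeSemiring.Exp
import Algebra.Properties.Group as GroupProperties
import Algebra.Properties.Ring
import Algebra.Properties.Semiring.Exp
import Algebra.Properties.Semiring.Mult
import Algebra.Properties.Semiring.Sum
import Algebra.Solver.Ring
import Data.Integer as ℤ
import Data.Integer.Properties as ℤₚ
import Data.Nat as ℕ
import Data.Nat.Properties as ℕₚ
import Data.Vec as Vec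
import Data.Vec.Relation.Binary.Pointwise.Inductive as Pointwise
import Relation.Binary.PropositionalEquality as ≡
import Relation.Binary.Reasoning.Setoid

-- A ring solver with integer coefficients over an arbitrary commutative ring.

module IntegerSolver (R : CommutativeRing 0ℓ 0ℓ) where

  open CommutativeRing R
  open Algebra.Properties.Ring ring using (-‿involutive; x[y-z]≈xy-xz; [y-z]x≈yx-zx)
  open Algebra.Properties.AbelianGroup +-abelianGroup using (⁻¹-∙-comm; ε⁻¹≈ε; x∙y⁻¹≈ε⇒x≈y; x≈y⇒x∙y⁻¹≈ε)
  open Algebra.Properties.CommutativeSemigroup +-commutativeSemigroup using (interchange)
  open Algebra.Properties.Semiring.Mult semiring renaming (_×_ to _·_)
  open Relation.Binary.Reasoning.Setoid setoid

  -- The pair (m , n) stands for the integer m - n.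
  differences : RawRing 0ℓ 0ℓ
  differences = record
    { Carrier = ℕ × ℕ
    ; _≈_ = _≡_
    ; _+_ = λ (a , b) (c , d) → a ℕ.+ c , b ℕ.+ d
    ; _*_ = λ (a , b) (c , d) → a ℕ.* c ℕ.+ b ℕ.* d , a ℕ.* d ℕ.+ b ℕ.* c
    ; -_ = λ (a , b) → b , a
    ; 0# = 0 , 0
    ; 1# = 1 , 0
    }

  value : ℕ × ℕ → Carrier
  value (a , b) = a · 1# - b · 1#

  minus-interchange : ∀ w x y z → (w + x) - (y + z) ≈ (w - y) + (x - z)
  minus-interchange w x y z = begin
    (w + x) - (y + z)         ≈⟨ +-congˡ (⁻¹-∙-comm y z) ⟨
    (w + x) + (- y + - z)     ≈⟨ interchange w x (- y) (- z) ⟩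
    (w - y) + (x - z)         ∎

  neg-difference : ∀ x y → - (x - y) ≈ y - x
  neg-difference x y = begin
    - (x - y)        ≈⟨ ⁻¹-∙-comm x (- y) ⟨
    - x + - (- y)    ≈⟨ +-congˡ (-‿involutive y) ⟩
    - x + y          ≈⟨ +-comm (- x) y ⟩
    y - x            ∎

  product-of-differences : ∀ w x y z → (w - x) * (y - z) ≈ (w * y + x * z) - (w * z + x * y)
  product-of-differences w x y z = begin
    (w - x) * (y - z)                          ≈⟨ [y-z]x≈yx-zx _ _ _ ⟩
    w * (y - z) - x * (y - z)                  ≈⟨ +-cong (x[y-z]≈xy-xz _ _ _) (-‿cong (x[y-z]≈xy-xz _ _ _)) ⟩
    (w * y - w * z) - (x * y - x * z)          ≈⟨ +-congˡ (neg-difference _ _) ⟩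
    (w * y - w * z) + (x * z - x * y)          ≈⟨ minus-interchange _ _ _ _ ⟨
    (w * y + x * z) - (w * z + x * y)          ∎

  -- Agrees with value, but computes to 0# and 1# so that solver constants can stand for them.
  integer : ℕ × ℕ → Carrier
  integer (0 , 0) = 0#
  integer (1 , 0) = 1#
  integer n       = value n

  integer≈value : ∀ n → integer n ≈ value n
  integer≈value (0 , 0)           = sym (-‿inverseʳ 0#)
  integer≈value (1 , 0)           = sym (trans (+-cong (×-homo-1 1#) ε⁻¹≈ε) (+-identityʳ 1#))
  integer≈value (0 , ℕ.suc _)     = refl
  integer≈value (1 , ℕ.suc _)     = refl
  integer≈value (ℕ.suc (ℕ.suc _) , _) = refl

  integer-homomorphism : differences -Raw-AlmostCommutative⟶ fromCommutativeRing R
  integer-homomorphism = record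
    { ⟦_⟧ = integer
    ; +-homo = λ m@(a , b) n@(c , d) → begin
        integer (a ℕ.+ c , b ℕ.+ d)                      ≈⟨ integer≈value (a ℕ.+ c , b ℕ.+ d) ⟩
        value (a ℕ.+ c , b ℕ.+ d)                        ≈⟨ +-cong (×-homo-+ 1# a c) (-‿cong (×-homo-+ 1# b d)) ⟩
        (a · 1# + c · 1#) - (b · 1# + d · 1#)            ≈⟨ minus-interchange _ _ _ _ ⟩
        value m + value n                                ≈⟨ +-cong (integer≈value m) (integer≈value n) ⟨
        integer m + integer n                            ∎
    ; *-homo = λ m@(a , b) n@(c , d) → begin
        integer (a ℕ.* c ℕ.+ b ℕ.* d , a ℕ.* d ℕ.+ b ℕ.* c)  ≈⟨ integer≈value (a ℕ.* c ℕ.+ b ℕ.* d , a ℕ.* d ℕ.+ b ℕ.* c) ⟩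
        value (a ℕ.* c ℕ.+ b ℕ.* d , a ℕ.* d ℕ.+ b ℕ.* c)    ≈⟨ +-cong (expand a c b d) (-‿cong (expand a d b c)) ⟩
        _                                                ≈⟨ product-of-differences _ _ _ _ ⟨
        value m * value n                                ≈⟨ *-cong (integer≈value m) (integer≈value n) ⟨
        integer m * integer n                            ∎
    ; -‿homo = λ n@(a , b) → begin
        integer (b , a)   ≈⟨ integer≈value (b , a) ⟩
        value (b , a)     ≈⟨ neg-difference _ _ ⟨
        - value n         ≈⟨ -‿cong (integer≈value n) ⟨
        - integer n       ∎
    ; 0-homo = refl
    ; 1-homo = refl
    }
    where
    expand : ∀ a b c d → (a ℕ.* b ℕ.+ c ℕ.* d) · 1# ≈ (a · 1#) * (b · 1#) + (c · 1#) * (d · 1#)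
    expand a b c d = trans (×-homo-+ 1# (a ℕ.* b) (c ℕ.* d)) (+-cong (×1-homo-* a b) (×1-homo-* c d))

  value-cong : ∀ a b c d → a ℕ.+ d ≡ c ℕ.+ b → value (a , b) ≈ value (c , d)
  value-cong a b c d eq = x∙y⁻¹≈ε⇒x≈y _ _ (begin
    (a · 1# - b · 1#) - (c · 1# - d · 1#)    ≈⟨ +-congˡ (neg-difference _ _) ⟩
    (a · 1# - b · 1#) + (d · 1# - c · 1#)    ≈⟨ minus-interchange _ _ _ _ ⟨
    (a · 1# + d · 1#) - (b · 1# + c · 1#)    ≈⟨ +-cong (×-homo-+ 1# a d) (-‿cong (trans (×-homo-+ 1# c b) (+-comm _ _))) ⟨
    ((a ℕ.+ d) · 1#) - ((c ℕ.+ b) · 1#)      ≈⟨ x≈y⇒x∙y⁻¹≈ε (×-congˡ eq) ⟩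
    0#                                       ∎)

  -- Pairs are not kept in lowest form, so two differences are compared by cross-addition.
  integer-≟ : WeaklyDecidable (Induced-equivalence integer-homomorphism)
  integer-≟ (a , b) (c , d) with a ℕ.+ d ℕ.≟ c ℕ.+ b
  ... | yes eq = just (trans (integer≈value (a , b)) (trans (value-cong a b c d eq) (sym (integer≈value (c , d)))))
  ... | no _   = nothing

  open Algebra.Solver.Ring differences (fromCommutativeRing R) integer-homomorphism integer-≟ public

-- Ideals and quotient rings.

module Ideals (R : CommutativeRing 0ℓ 0ℓ) where

  open CommutativeRing R
  open IntegerSolver R using (solve; _:+_; _:*_; :-_; _:-_; _:=_; con)

  record Ideal : Set₁ where
    field
      _∈I      : Carrier → Set
      resp     : ∀ {x y} → x ≈ y → x ∈I → y ∈I
      0∈       : 0# ∈I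
      +-closed : ∀ {x y} → x ∈I → y ∈I → (x + y) ∈I
      *-closed : ∀ r {x} → x ∈I → (r * x) ∈I

  Proper : Ideal → Set
  Proper I = ¬ (1# ∈I) where open Ideal I

  -- The ideal I + (c). Only the multiplier of c is recorded; the part in I is then determined as x
  -- - r c.
  adjoin : Carrier → Ideal → Ideal
  adjoin c I = record
    { _∈I = λ x → Σ Carrier λ r → (x - r * c) ∈I
    ; resp = λ x≈y (r , h) → r , resp (+-congʳ x≈y) h
    ; 0∈ = 0# , resp (solve 1 (λ c → con (0 , 0) := con (0 , 0) :- con (0 , 0) :* c) refl c) 0∈
    ; +-closed = λ {x} {y} (r , h) (s , k) → r + s , resp
        (solve 5 (λ x y r s c → (x :- r :* c) :+ (y :- s :* c) := (x :+ y) :- (r :+ s) :* c) refl x y r s c)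
        (+-closed h k)
    ; *-closed = λ s {x} (r , h) → s * r , resp
        (solve 4 (λ x r s c → s :* (x :- r :* c) := s :* x :- s :* r :* c) refl x r s c)
        (*-closed s h)
    }
    where open Ideal I

  ⊆-adjoin : ∀ c I {x} → Ideal._∈I I x → Ideal._∈I (adjoin c I) x
  ⊆-adjoin c I {x} h = 0# , resp (solve 2 (λ x c → x := x :- con (0 , 0) :* c) refl x c) h
    where open Ideal I

  ∈-adjoin : ∀ c I → Ideal._∈I (adjoin c I) c
  ∈-adjoin c I = 1# , resp (solve 1 (λ c → con (0 , 0) := c :- con (1 , 0) :* c) refl c) 0∈
    where open Ideal I

  zeroIdeal : Ideal
  zeroIdeal = record
    { _∈I = _≈ 0#
    ; resp = λ x≈y x≈0 → trans (sym x≈y) x≈0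
    ; 0∈ = refl
    ; +-closed = λ h k → trans (+-cong h k) (+-identityˡ 0#)
    ; *-closed = λ r h → trans (*-congˡ h) (zeroʳ r)
    }

  Π : List Carrier → Carrier
  Π []       = 1#
  Π (x ∷ xs) = x * Π xs

  -- If 1 ∈ I + (y), then multiplying by Π ys and using y * Π ys ∈ I gives Π ys ∈ I.
  adjoin-factor : ∀ (I : Ideal) → Proper I → ∀ ys → Ideal._∈I I (Π ys) → ¬ ¬ Any (λ y → Proper (adjoin y I)) ys
  adjoin-factor I proper []       Π∈ none = proper Π∈
  adjoin-factor I proper (y ∷ ys) Π∈ none = none (here λ (r , h) →
    adjoin-factor I proper ys (resp
      (solve 3 (λ r y P → P :* (con (1 , 0) :- r :* y) :+ r :* (y :* P) := P) refl r y (Π ys))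
      (+-closed (*-closed (Π ys) h) (*-closed r Π∈)))
    (λ some → none (there some)))
    where open Ideal I

  ≈⇒-∈ : ∀ I {x y} → x ≈ y → Ideal._∈I I (x - y)
  ≈⇒-∈ I {x} {y} h = resp (sym (trans (+-congʳ h) (-‿inverseʳ y))) 0∈
    where open Ideal I

  -- Only the equality changes. Elements of R, the chosen roots among them, are literally elements
  -- of every quotient, so no projection map has to be carried along.
  quotient : Ideal → CommutativeRing 0ℓ 0ℓ
  quotient I = record
    { Carrier = Carrier
    ; _≈_ = λ x y → (x - y) ∈I
    ; _+_ = _+_ ; _*_ = _*_ ; -_ = -_ ; 0# = 0# ; 1# = 1#
    ; isCommutativeRing = record
      { isRing = record
        { +-isAbelianGroup = record
          { isGroup = record
            { isMonoid = record
              { isSemigroup = record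
                { isMagma = record
                  { isEquivalence = record
                    { refl = λ {x} → ≈⇒-∈ I refl
                    ; sym = λ {x} {y} h → resp
                        (solve 2 (λ x y → (:- con (1 , 0)) :* (x :- y) := y :- x) refl x y) (*-closed _ h)
                    ; trans = λ {x} {y} {z} h k → resp
                        (solve 3 (λ x y z → (x :- y) :+ (y :- z) := x :- z) refl x y z) (+-closed h k)
                    }
                  ; ∙-cong = λ {x} {y} {u} {v} h k → resp
                      (solve 4 (λ x y u v → (x :- y) :+ (u :- v) := (x :+ u) :- (y :+ v)) refl x y u v) (+-closed h k)
                  }
                ; assoc = λ x y z → ≈⇒-∈ I (+-assoc x y z) }
              ; identity = (λ x → ≈⇒-∈ I (+-identityˡ x)) , (λ x → ≈⇒-∈ I (+-identityʳ x))
              }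
            ; inverse = (λ x → ≈⇒-∈ I (-‿inverseˡ x)) , (λ x → ≈⇒-∈ I (-‿inverseʳ x))
            ; ⁻¹-cong = λ {x} {y} h → resp
                (solve 2 (λ x y → (:- con (1 , 0)) :* (x :- y) := (:- x) :- (:- y)) refl x y) (*-closed _ h)
            }
          ; comm = λ x y → ≈⇒-∈ I (+-comm x y)
          }
        ; *-cong = λ {x} {y} {u} {v} h k → resp
            (solve 4 (λ x y u v → u :* (x :- y) :+ y :* (u :- v) := x :* u :- y :* v) refl x y u v)
            (+-closed (*-closed u h) (*-closed y k))
        ; *-assoc = λ x y z → ≈⇒-∈ I (*-assoc x y z)
        ; *-identity = (λ x → ≈⇒-∈ I (*-identityˡ x)) , (λ x → ≈⇒-∈ I (*-identityʳ x))
        ; distrib = (λ x y z → ≈⇒-∈ I (distribˡ x y z)) , (λ x y z → ≈⇒-∈ I (distribʳ x y z))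
        }
      ; *-comm = λ x y → ≈⇒-∈ I (*-comm x y)
      }
    }
    where open Ideal I

-- Monic polynomials, their derivatives and their linear factors.

module MonicPolynomials (R : CommutativeRing 0ℓ 0ℓ) where

  open CommutativeRing R
  open IntegerSolver R using (solve; _:+_; _:*_; :-_; _:-_; _:=_; con)
  open Relation.Binary.Reasoning.Setoid setoid

  infix 4 _≋_
  _≋_ : ∀ {n} → Vec Carrier n → Vec Carrier n → Set
  _≋_ = Pointwise _≈_

  -- A vector of length n lists the coefficients, constant term first, of a monic polynomial of
  -- degree n; the leading coefficient is omitted.
  eval : ∀ {n} → Vec Carrier n → Carrier → Carrier
  eval []       t = 1#
  eval (c ∷ cs) t = c + t * eval cs t

  deriv : ∀ {n} → Vec Carrier n → Carrier → Carrier
  deriv []       t = 0#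
  deriv (c ∷ cs) t = eval cs t + t * deriv cs t

  -- The polynomial p + (T - α) g.
  linear : ∀ {n} → Carrier → Carrier → Vec Carrier n → Vec Carrier (suc n)
  linear α p []       = (p - α) ∷ []
  linear α p (c ∷ cs) = (p - α * c) ∷ linear α c cs

  fromRoots : ∀ {n} → Vec Carrier n → Vec Carrier n
  fromRoots []       = []
  fromRoots (α ∷ αs) = linear α 0# (fromRoots αs)

  eval-cong : ∀ {n} {f g : Vec Carrier n} t → f ≋ g → eval f t ≈ eval g t
  eval-cong t []       = refl
  eval-cong t (h ∷ hs) = +-cong h (*-congˡ (eval-cong t hs))

  deriv-cong : ∀ {n} {f g : Vec Carrier n} t → f ≋ g → deriv f t ≈ deriv g t
  deriv-cong t []       = refl
  deriv-cong t (h ∷ hs) = +-cong (eval-cong t hs) (*-congˡ (deriv-cong t hs))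

  linear-cong : ∀ {n} α {p p′} {f g : Vec Carrier n} → p ≈ p′ → f ≋ g → linear α p f ≋ linear α p′ g
  linear-cong α p≈ []       = +-congʳ p≈ ∷ []
  linear-cong α p≈ (h ∷ hs) = +-cong p≈ (-‿cong (*-congˡ h)) ∷ linear-cong α h hs

  eval-linear : ∀ {n} α p (g : Vec Carrier n) t → eval (linear α p g) t ≈ p + (t - α) * eval g t
  eval-linear α p []       t =
    solve 3 (λ α p t → (p :- α) :+ t :* con (1 , 0) := p :+ (t :- α) :* con (1 , 0)) refl α p t
  eval-linear α p (c ∷ cs) t = trans (+-congˡ (*-congˡ (eval-linear α c cs t)))
    (solve 5 (λ α p t c E → (p :- α :* c) :+ t :* (c :+ (t :- α) :* E) := p :+ (t :- α) :* (c :+ t :* E))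
      refl α p t c (eval cs t))

  deriv-linear : ∀ {n} α p (g : Vec Carrier n) t →
                 deriv (linear α p g) t ≈ eval g t + (t - α) * deriv g t
  deriv-linear α p []       t =
    solve 2 (λ α t → con (1 , 0) :+ t :* con (0 , 0) := con (1 , 0) :+ (t :- α) :* con (0 , 0)) refl α t
  deriv-linear α p (c ∷ cs) t =
    trans (+-cong (eval-linear α c cs t) (*-congˡ (deriv-linear α c cs t)))
    (solve 5 (λ α t c E D → (c :+ (t :- α) :* E) :+ t :* (E :+ (t :- α) :* D)
                         := (c :+ t :* E) :+ (t :- α) :* (E :+ t :* D))
      refl α t c (eval cs t) (deriv cs t))

  -- Horner's scheme: the quotient's coefficients are the values at α of the successive tails of f,
  -- and the remainder is f(α).
  divide : ∀ {n} (f : Vec Carrier (suc n)) α → ∃ λ g → f ≋ linear α (eval f α) g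
  divide (c ∷ []) α = [] , solve 2 (λ c α → c := (c :+ α :* con (1 , 0)) :- α) refl c α ∷ []
  divide (c ∷ f@(_ ∷ _)) α with divide f α
  ... | g , f≋ = eval f α ∷ g ,
    solve 3 (λ c α E → c := (c :+ α :* E) :- α :* E) refl c α (eval f α) ∷ f≋

  eval-fromRoots-∷ : ∀ {n} α (αs : Vec Carrier n) t →
                     eval (fromRoots (α ∷ αs)) t ≈ (t - α) * eval (fromRoots αs) t
  eval-fromRoots-∷ α αs t = trans (eval-linear α 0# (fromRoots αs) t) (+-identityˡ _)

  eval-divisible : ∀ {n} (αs : Vec Carrier n) j t →
                   ∃ λ r → eval (fromRoots αs) t ≈ r * (t - lookup αs j)
  eval-divisible (α ∷ αs) zero    t = eval (fromRoots αs) t , trans (eval-fromRoots-∷ α αs t) (*-comm _ _)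
  eval-divisible (α ∷ αs) (suc j) t with eval-divisible αs j t
  ... | r , eq = (t - α) * r , trans (eval-fromRoots-∷ α αs t) (trans (*-congˡ eq) (sym (*-assoc _ _ _)))

  eval-root : ∀ {n} (αs : Vec Carrier n) j → eval (fromRoots αs) (lookup αs j) ≈ 0#
  eval-root αs j with eval-divisible αs j (lookup αs j)
  ... | r , eq = trans eq (trans (*-congˡ (-‿inverseʳ _)) (zeroʳ r))

  -- By the product rule the derivative at αᵢ reduces to the product of all αᵢ - αₖ with k ≠ i, and
  -- αᵢ - αⱼ is one of these factors.
  deriv-divisible : ∀ {n} (αs : Vec Carrier n) i j → i ≢ j →
    ∃ λ r → deriv (fromRoots αs) (lookup αs i) ≈ r * (lookup αs i - lookup αs j)
  deriv-divisible (α ∷ αs) zero zero i≢j = ⊥-elim (i≢j ≡.refl)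
  deriv-divisible (α ∷ αs) zero (suc j) _ with eval-divisible αs j α
  ... | r , eq = r , (begin
    deriv (linear α 0# (fromRoots αs)) α       ≈⟨ deriv-linear α 0# (fromRoots αs) α ⟩
    E + (α - α) * D                            ≈⟨ solve 3 (λ E α D → E :+ (α :- α) :* D := E) refl E α D ⟩
    E                                          ≈⟨ eq ⟩
    r * (α - lookup αs j)                      ∎)
    where
    E = eval (fromRoots αs) α
    D = deriv (fromRoots αs) α
  deriv-divisible (α ∷ αs) (suc i) zero _ = deriv (fromRoots αs) β , (begin
    deriv (linear α 0# (fromRoots αs)) β                              ≈⟨ deriv-linear α 0# (fromRoots αs) β ⟩
    eval (fromRoots αs) β + (β - α) * deriv (fromRoots αs) β          ≈⟨ +-cong (eval-root αs i) (*-comm _ _) ⟩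
    0# + deriv (fromRoots αs) β * (β - α)                             ≈⟨ +-identityˡ _ ⟩
    deriv (fromRoots αs) β * (β - α)                                  ∎)
    where β = lookup αs i
  deriv-divisible (α ∷ αs) (suc i) (suc j) i≢j with deriv-divisible αs i j (λ eq → i≢j (≡.cong suc eq))
  ... | r , eq = (β - α) * r , (begin
    deriv (linear α 0# (fromRoots αs)) β                              ≈⟨ deriv-linear α 0# (fromRoots αs) β ⟩
    eval (fromRoots αs) β + (β - α) * deriv (fromRoots αs) β          ≈⟨ +-cong (eval-root αs i) (*-congˡ eq) ⟩
    0# + (β - α) * (r * (β - lookup αs j))                            ≈⟨ +-identityˡ _ ⟩
    (β - α) * (r * (β - lookup αs j))                                 ≈⟨ *-assoc _ _ _ ⟨
    (β - α) * r * (β - lookup αs j)                                   ∎)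
    where β = lookup αs i

-- Adjoining a root of a monic polynomial of positive degree.

module AdjoinRoot (R : CommutativeRing 0ℓ 0ℓ) {n} (f : Vec (CommutativeRing.Carrier R) (suc n)) where

  open CommutativeRing R
  open IntegerSolver R using (solve; _:+_; _:*_; :-_; _:-_; _:=_; con)

  -- R[T]/(f) is realised by letting polynomial expressions act on sequences over R, with T acting as
  -- the shift; two expressions are identified when they agree on the sequences annihilated by f(T).
  -- It is nonzero because the linear recurrence with characteristic polynomial f has solutions.
  data Expr : Set where
    const   : Carrier → Expr
    root    : Expr
    _⊕_ _⊗_ : Expr → Expr → Expr
    ⊖_      : Expr → Expr

  Sequence : Set
  Sequence = ℕ → Carrier

  infix 4 _≗_
  _≗_ : Sequence → Sequence → Set
  s ≗ u = ∀ k → s k ≈ u k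

  shift : Sequence → Sequence
  shift s k = s (suc k)

  act : Expr → Sequence → Sequence
  act (const r) s k = r * s k
  act root      s k = s (suc k)
  act (a ⊕ b)   s k = act a s k + act b s k
  act (a ⊗ b)   s   = act a (act b s)
  act (⊖ a)     s k = - act a s k

  act-cong : ∀ e {s u} → s ≗ u → act e s ≗ act e u
  act-cong (const r) h k = *-congˡ (h k)
  act-cong root      h k = h (suc k)
  act-cong (a ⊕ b)   h k = +-cong (act-cong a h k) (act-cong b h k)
  act-cong (a ⊗ b)   h   = act-cong a (act-cong b h)
  act-cong (⊖ a)     h k = -‿cong (act-cong a h k)

  act-+ : ∀ e s u → act e (λ k → s k + u k) ≗ λ k → act e s k + act e u k
  act-+ (const r) s u k = distribˡ r (s k) (u k)
  act-+ root      s u k = refl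
  act-+ (a ⊕ b)   s u k = trans (+-cong (act-+ a s u k) (act-+ b s u k))
    (solve 4 (λ w x y z → (w :+ x) :+ (y :+ z) := (w :+ y) :+ (x :+ z)) refl _ _ _ _)
  act-+ (a ⊗ b)   s u k = trans (act-cong a (act-+ b s u) k) (act-+ a (act b s) (act b u) k)
  act-+ (⊖ a)     s u k = trans (-‿cong (act-+ a s u k)) (solve 2 (λ x y → :- (x :+ y) := :- x :- y) refl _ _)

  act-* : ∀ e r s → act e (λ k → r * s k) ≗ λ k → r * act e s k
  act-* (const c) r s k = solve 3 (λ c r x → c :* (r :* x) := r :* (c :* x)) refl c r (s k)
  act-* root      r s k = refl
  act-* (a ⊕ b)   r s k = trans (+-cong (act-* a r s k) (act-* b r s k)) (sym (distribˡ _ _ _))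
  act-* (a ⊗ b)   r s k = trans (act-cong a (act-* b r s) k) (act-* a r (act b s) k)
  act-* (⊖ a)     r s k = trans (-‿cong (act-* a r s k)) (solve 2 (λ r x → :- (r :* x) := r :* (:- x)) refl r _)

  act-neg : ∀ e s → act e (λ k → - s k) ≗ λ k → - act e s k
  act-neg e s k = trans (act-cong e (λ k → minus (s k)) k) (trans (act-* e (- 1#) s k) (sym (minus _)))
    where
    minus : ∀ x → - x ≈ - 1# * x
    minus = solve 1 (λ x → :- x := (:- con (1 , 0)) :* x) refl

  act-shift : ∀ e s → act e (shift s) ≗ shift (act e s)
  act-shift (const r) s k = refl
  act-shift root      s k = refl
  act-shift (a ⊕ b)   s k = +-cong (act-shift a s k) (act-shift b s k)
  act-shift (a ⊗ b)   s k = trans (act-cong a (act-shift b s) k) (act-shift a (act b s) k)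
  act-shift (⊖ a)     s k = -‿cong (act-shift a s k)

  -- Products act by composition, so commutativity is not a pointwise law. It holds because every
  -- operator is built from scalars and the shift, and these commute with everything so built.
  act-comm : ∀ a b s → act a (act b s) ≗ act b (act a s)
  act-comm (const r) b s k = sym (act-* b r s k)
  act-comm root      b s k = sym (act-shift b s k)
  act-comm (a ⊕ a′)  b s k = trans (+-cong (act-comm a b s k) (act-comm a′ b s k)) (sym (act-+ b _ _ k))
  act-comm (a ⊗ a′)  b s k = trans (act-cong a (act-comm a′ b s) k) (act-comm a b (act a′ s) k)
  act-comm (⊖ a)     b s k = trans (-‿cong (act-comm a b s k)) (sym (act-neg b _ k))

  value : ∀ {m} → Vec Carrier m → Expr
  value []       = const 1#
  value (c ∷ cs) = const c ⊕ (root ⊗ value cs)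

  Annihilated : Sequence → Set
  Annihilated s = act (value f) s ≗ λ _ → 0#

  -- Every operator commutes with f(T), so it preserves the kernel of f(T). This makes the product
  -- of expressions respect `_∼_`.
  act-Annihilated : ∀ e {s} → Annihilated s → Annihilated (act e s)
  act-Annihilated e {s} h k = trans (act-comm (value f) e s k) (trans (act-cong e zeros k)
    (trans (act-* e 0# s k) (zeroˡ _)))
    where
    zeros : act (value f) s ≗ λ k → 0# * s k
    zeros k = trans (h k) (sym (zeroˡ _))

  infix 4 _∼_
  record _∼_ (a b : Expr) : Set where
    constructor acting
    field acts : ∀ s → Annihilated s → act a s ≗ act b s
  open _∼_ public

  extension : CommutativeRing 0ℓ 0ℓ
  extension = record
    { Carrier = Expr
    ; _≈_ = _∼_
    ; _+_ = _⊕_ ; _*_ = _⊗_ ; -_ = ⊖_ ; 0# = const 0# ; 1# = const 1#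
    ; isCommutativeRing = record
      { isRing = record
        { +-isAbelianGroup = record
          { isGroup = record
            { isMonoid = record
              { isSemigroup = record
                { isMagma = record
                  { isEquivalence = record
                    { refl = acting λ s _ k → refl
                    ; sym = λ h → acting λ s z k → sym (acts h s z k)
                    ; trans = λ h h′ → acting λ s z k → trans (acts h s z k) (acts h′ s z k)
                    }
                  ; ∙-cong = λ h h′ → acting λ s z k → +-cong (acts h s z k) (acts h′ s z k)
                  }
                ; assoc = λ a b c → acting λ s _ k → +-assoc _ _ _
                }
              ; identity = (λ a → acting λ s _ k → trans (+-congʳ (zeroˡ _)) (+-identityˡ _))
                         , (λ a → acting λ s _ k → trans (+-congˡ (zeroˡ _)) (+-identityʳ _))
              }
            ; inverse = (λ a → acting λ s _ k → trans (-‿inverseˡ _) (sym (zeroˡ _)))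
                      , (λ a → acting λ s _ k → trans (-‿inverseʳ _) (sym (zeroˡ _)))
            ; ⁻¹-cong = λ h → acting λ s z k → -‿cong (acts h s z k)
            }
          ; comm = λ a b → acting λ s _ k → +-comm _ _
          }
        ; *-cong = λ {a} {b} {c} {d} h h′ → acting λ s z k →
            trans (acts h (act c s) (act-Annihilated c z) k) (act-cong b (acts h′ s z) k)
        ; *-assoc = λ a b c → acting λ s _ k → refl
        ; *-identity = (λ a → acting λ s _ k → *-identityˡ _)
                     , (λ a → acting λ s _ k → act-cong a (λ k → *-identityˡ (s k)) k)
        ; distrib = (λ a b c → acting λ s _ k → act-+ a (act b s) (act c s) k)
                  , (λ a b c → acting λ s _ k → refl)
        }
      ; *-comm = λ a b → acting λ s _ k → act-comm a b s k
      }
    }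

  private module E = CommutativeRing extension

  const-isRingHomomorphism : IsRingHomomorphism rawRing E.rawRing const
  const-isRingHomomorphism = record
    { isSemiringHomomorphism = record
      { isNearSemiringHomomorphism = record
        { +-isMonoidHomomorphism = record
          { isMagmaHomomorphism = record
            { isRelHomomorphism = record { cong = λ h → acting λ s _ k → *-congʳ h }
            ; homo = λ a b → acting λ s _ k → distribʳ _ a b
            }
          ; ε-homo = E.refl
          }
        ; *-homo = λ a b → acting λ s _ k → *-assoc a b _
        }
      ; 1#-homo = E.refl
      }
    ; -‿homo = λ a → acting λ s _ k → solve 2 (λ a x → (:- a) :* x := :- (a :* x)) refl a _
    }

  open MonicPolynomials extension using (eval)

  eval-map-root : ∀ {m} (cs : Vec Carrier m) → eval (Vec.map const cs) root ≡ value cs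
  eval-map-root []       = ≡.refl
  eval-map-root (c ∷ cs) = ≡.cong (λ e → const c ⊕ (root ⊗ e)) (eval-map-root cs)

  root-is-root : eval (Vec.map const f) root ∼ const 0#
  root-is-root = acting λ s z k → trans (reflexive (≡.cong (λ e → act e s k) (eval-map-root f)))
    (trans (z k) (sym (zeroˡ _)))

  dot : ∀ {m} → Vec Carrier m → Vec Carrier m → Carrier
  dot []       []       = 0#
  dot (c ∷ cs) (x ∷ xs) = c * x + dot cs xs

  -- The state of the recurrence is a window of n + 1 consecutive terms. Since f is monic, the next
  -- term is minus the combination of the window with the lower coefficients.
  step : Vec Carrier (suc n) → Vec Carrier (suc n)
  step (x ∷ xs) = xs ∷ʳ (- dot f (x ∷ xs))

  run : Vec Carrier (suc n) → Sequence
  run v zero    = head v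
  run v (suc k) = run (step v) k

  data _StartsWith_ (s : Sequence) : ∀ {m} → Vec Carrier m → Set where
    []  : s StartsWith []
    _∷_ : ∀ {m x} {xs : Vec Carrier m} → s 0 ≈ x → shift s StartsWith xs → s StartsWith (x ∷ xs)

  -- The omitted leading coefficient 1 contributes y, the term just after the window.
  act-value : ∀ {m} (cs xs : Vec Carrier m) y s → s StartsWith (xs ∷ʳ y) → act (value cs) s 0 ≈ dot cs xs + y
  act-value []       []       y s (h ∷ _)  = trans (*-identityˡ _) (trans h (sym (+-identityˡ y)))
  act-value (c ∷ cs) (x ∷ xs) y s (h ∷ hs) = trans
    (+-cong (*-congˡ h) (trans (sym (act-shift (value cs) s 0)) (act-value cs xs y (shift s) hs)))
    (sym (+-assoc _ _ _))

  data _≼_ : ∀ {l m} → Vec Carrier l → Vec Carrier m → Set where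
    []  : ∀ {m} {ys : Vec Carrier m} → [] ≼ ys
    _∷_ : ∀ {l m} x {xs : Vec Carrier l} {ys : Vec Carrier m} → xs ≼ ys → (x ∷ xs) ≼ (x ∷ ys)

  ≼-refl : ∀ {m} (xs : Vec Carrier m) → xs ≼ xs
  ≼-refl []       = []
  ≼-refl (x ∷ xs) = x ∷ ≼-refl xs

  ≼-∷ʳ : ∀ {l m} {xs : Vec Carrier l} {ys : Vec Carrier m} y → xs ≼ ys → xs ≼ (ys ∷ʳ y)
  ≼-∷ʳ y []      = []
  ≼-∷ʳ y (x ∷ h) = x ∷ ≼-∷ʳ y h

  -- Each step drops the head and appends a new term at the end, so the induction goes through for
  -- prefixes of the window rather than for the whole window.
  run-StartsWith : ∀ {m} {xs : Vec Carrier m} v → xs ≼ v → run v StartsWith xs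
  run-StartsWith v         []      = []
  run-StartsWith (x ∷ xs)  (x ∷ h) = refl ∷ run-StartsWith (step (x ∷ xs)) (≼-∷ʳ _ h)

  -- At position 0 the appended term was chosen to cancel the others; position k + 1 is position k
  -- of the run that starts one step later.
  run-Annihilated : ∀ v → Annihilated (run v)
  run-Annihilated v@(x ∷ _) zero    = trans
    (act-value f v _ (run v) (refl ∷ run-StartsWith (step v) (≼-refl (step v)))) (-‿inverseʳ _)
  run-Annihilated v (suc k) = trans (sym (act-shift (value f) (run v) k)) (run-Annihilated (step v) k)

  -- An annihilated sequence with first term 1 separates `const 1#` from `const 0#`.
  extension-nontrivial : ¬ 1# ≈ 0# → ¬ const 1# ∼ const 0#
  extension-nontrivial 1≉0 h = 1≉0 (trans (sym (*-identityˡ 1#))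
    (trans (acts h (run ones) (run-Annihilated ones) 0) (zeroˡ 1#)))
    where ones = Vec.replicate (suc n) 1#

-- Nonzero overrings in which a monic polynomial splits.

record SplittingRing (R : CommutativeRing 0ℓ 0ℓ) {n} (f : Vec (CommutativeRing.Carrier R) n) : Set₁ where
  field
    overring    : CommutativeRing 0ℓ 0ℓ
  open CommutativeRing overring
  field
    embed       : CommutativeRing.Carrier R → Carrier
    isHom       : IsRingHomomorphism (CommutativeRing.rawRing R) rawRing embed
    nontrivial  : ¬ 1# ≈ 0#
    roots       : Vec Carrier n
    splits      : MonicPolynomials._≋_ overring (Vec.map embed f) (MonicPolynomials.fromRoots overring roots)

module _ {R S : CommutativeRing 0ℓ 0ℓ} where
  private
    module R = CommutativeRing R
    module S = CommutativeRing S
    module PR = MonicPolynomials R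
    module PS = MonicPolynomials S

  module _ {φ : R.Carrier → S.Carrier} (hom : IsRingHomomorphism R.rawRing S.rawRing φ) where
    open IsRingHomomorphism hom

    map-cong-≋ : ∀ {n} {f g : Vec R.Carrier n} → f PR.≋ g → Vec.map φ f PS.≋ Vec.map φ g
    map-cong-≋ []       = []
    map-cong-≋ (h ∷ hs) = ⟦⟧-cong h ∷ map-cong-≋ hs

    map-linear : ∀ {n} α {p} {p′} (g : Vec R.Carrier n) → φ p S.≈ p′ →
                 Vec.map φ (PR.linear α p g) PS.≋ PS.linear (φ α) p′ (Vec.map φ g)
    map-linear α []       p≈ = S.trans (+-homo _ _) (S.+-cong p≈ (-‿homo α)) ∷ []
    map-linear α (c ∷ cs) p≈ =
      S.trans (+-homo _ _) (S.+-cong p≈ (S.trans (-‿homo _) (S.-‿cong (*-homo α c))))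
      ∷ map-linear α cs S.refl

-- Induction on the degree: adjoin one root, divide by the linear factor, and split the quotient
-- over the extension.
splittingRing : ∀ (R : CommutativeRing 0ℓ 0ℓ) → let open CommutativeRing R in
                ¬ 1# ≈ 0# → ∀ {n} (f : Vec Carrier n) → SplittingRing R f
splittingRing R 1≉0 [] = record
  { overring = R ; embed = λ x → x ; isHom = Identity.isRingHomomorphism rawRing refl
  ; nontrivial = 1≉0 ; roots = [] ; splits = [] }
  where open CommutativeRing R
splittingRing R 1≉0 {suc n} f = record
  { overring = S.overring
  ; embed = λ x → S.embed (const x)
  ; isHom = Composition.isRingHomomorphism (CommutativeRing.trans S.overring) const-isRingHomomorphism S.isHom
  ; nontrivial = S.nontrivial
  ; roots = S.embed root ∷ S.roots
  ; splits = Pointwise.trans T.trans (≡.subst (PS._≋ Vec.map S.embed (linear root 0# g)) (≡.sym (Vec-map-∘ S.embed const f)) (map-cong-≋ {R = extension} {S.overring} S.isHom f≋))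
     (Pointwise.trans T.trans (map-linear S.isHom root g (IsRingHomomorphism.0#-homo S.isHom))
       (PS.linear-cong (S.embed root) T.refl S.splits))
  }
  where
  open AdjoinRoot R f
  open MonicPolynomials extension
  open CommutativeRing extension
  quot = divide (Vec.map const f) root
  g = proj₁ quot
  -- The remainder of the division is f(root), which is zero in the extension.
  f≋ : Vec.map const f ≋ linear root 0# g
  f≋ = Pointwise.trans trans (proj₂ quot) (linear-cong root root-is-root (Pointwise.refl refl))
  module S = SplittingRing (splittingRing extension (extension-nontrivial 1≉0) g)
  module T = CommutativeRing S.overring
  module PS = MonicPolynomials S.overring

-- Binomial coefficients modulo a prime and the Frobenius map.

C-absorption : ∀ n k → suc k ℕ.* (suc n C suc k) ≡ suc n ℕ.* (n C k)
C-absorption zero zero = ≡.refl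
C-absorption zero (suc k) = begin
  suc (suc k) ℕ.* (1 C suc (suc k))   ≡⟨ ≡.cong (suc (suc k) ℕ.*_) (k>n⇒nCk≡0 {1} {suc (suc k)} (s≤s (s≤s ℕ.z≤n))) ⟩
  suc (suc k) ℕ.* 0                   ≡⟨ ℕₚ.*-zeroʳ (suc (suc k)) ⟩
  0                                   ≡⟨ k>n⇒nCk≡0 {0} {suc k} (s≤s ℕ.z≤n) ⟨
  0 C suc k                           ≡⟨ ℕₚ.+-identityʳ (0 C suc k) ⟨
  1 ℕ.* (0 C suc k)                   ∎
  where open ≡.≡-Reasoning
C-absorption (suc n) zero = begin
  1 ℕ.* (suc (suc n) C 1)             ≡⟨ ℕₚ.+-identityʳ _ ⟩
  suc (suc n) C 1                     ≡⟨ nC1≡n (suc (suc n)) ⟩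
  suc (suc n)                         ≡⟨ ℕₚ.*-identityʳ _ ⟨
  suc (suc n) ℕ.* 1                   ∎
  where open ≡.≡-Reasoning
C-absorption (suc n) (suc k) = begin
  (2 ℕ.+ k) ℕ.* (suc (suc n) C suc (suc k))     ≡⟨ ≡.cong ((2 ℕ.+ k) ℕ.*_) (nCk+nC[k+1]≡[n+1]C[k+1] (suc n) (suc k)) ⟨
  (2 ℕ.+ k) ℕ.* (a ℕ.+ b)                       ≡⟨ expand k a b ⟩
  a ℕ.+ (suc k ℕ.* a ℕ.+ (2 ℕ.+ k) ℕ.* b)       ≡⟨ ≡.cong (a ℕ.+_) (≡.cong₂ ℕ._+_ (C-absorption n k) (C-absorption n (suc k))) ⟩
  a ℕ.+ (suc n ℕ.* (n C k) ℕ.+ suc n ℕ.* (n C suc k)) ≡⟨ ≡.cong (a ℕ.+_) (ℕₚ.*-distribˡ-+ (suc n) (n C k) (n C suc k)) ⟨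
  a ℕ.+ suc n ℕ.* (n C k ℕ.+ n C suc k)         ≡⟨ ≡.cong (λ z → a ℕ.+ suc n ℕ.* z) (nCk+nC[k+1]≡[n+1]C[k+1] n k) ⟩
  suc (suc n) ℕ.* a                             ∎
  where
  open ≡.≡-Reasoning
  a = suc n C suc k
  b = suc n C suc (suc k)
  expand : ∀ k a b → (2 ℕ.+ k) ℕ.* (a ℕ.+ b) ≡ a ℕ.+ (suc k ℕ.* a ℕ.+ (2 ℕ.+ k) ℕ.* b)
  expand = solve 3 (λ k a b → (con 2 :+ k) :* (a :+ b) := a :+ ((con 1 :+ k) :* a :+ (con 2 :+ k) :* b)) ≡.refl
    where open +-*-Solver

-- The prime n + 1 divides (k + 1) times the coefficient by `C-absorption`, and k + 1 is too small
-- to be a multiple of it.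
prime∣C : ∀ {n k} → Prime (suc n) → k ℕ.< n → suc n ∣ suc n C suc k
prime∣C {n} {k} pr k<n with euclidsLemma (suc k) (suc n C suc k) pr
  (≡.subst (suc n ∣_) (≡.sym (C-absorption n k)) (m∣m*n (n C k)))
... | inj₁ p∣k = ⊥-elim (ℕₚ.<⇒≱ (s≤s k<n) (∣⇒≤ p∣k))
... | inj₂ p∣C = p∣C

module Characteristic (R : CommutativeRing 0ℓ 0ℓ) where
  open CommutativeRing R hiding (zero)
  open Algebra.Properties.Semiring.Mult semiring renaming (_×_ to _·_)
  open Algebra.Properties.Semiring.Exp semiring
  open Algebra.Properties.Semiring.Sum semiring
  open Relation.Binary.Reasoning.Setoid setoid

  multiple-vanishes : ∀ {p} → p · 1# ≈ 0# → ∀ {m} → p ∣ m → ∀ x → m · x ≈ 0#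
  multiple-vanishes {p} p≈0 (divides k ≡.refl) x = begin
    (k ℕ.* p) · x          ≈⟨ ×-congʳ (k ℕ.* p) (*-identityˡ x) ⟨
    (k ℕ.* p) · (1# * x)   ≈⟨ ×-assoc-* (k ℕ.* p) 1# x ⟨
    (k ℕ.* p) · 1# * x     ≈⟨ *-congʳ (×1-homo-* k p) ⟩
    k · 1# * p · 1# * x    ≈⟨ *-congʳ (*-congˡ p≈0) ⟩
    k · 1# * 0# * x        ≈⟨ *-congʳ (zeroʳ _) ⟩
    0# * x                 ≈⟨ zeroˡ x ⟩
    0#                     ∎

  -- Every term of the binomial expansion other than the first and the last has a coefficient
  -- divisible by p.
  freshmans-dream : ∀ {p} → Prime p → p · 1# ≈ 0# → ∀ x y → (x + y) ^ p ≈ x ^ p + y ^ p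
  freshmans-dream {zero} pr _ _ _ = ⊥-elim (¬prime[0] pr)
  freshmans-dream {suc n} pr p≈0 x y = begin
    (x + y) ^ suc n                                 ≈⟨ Binomial.theorem (suc n) x y ⟩
    t zero + sum (tail t)                           ≈⟨ +-congˡ (sum-init-last (tail t)) ⟩
    t zero + (sum (init (tail t)) + last (tail t))  ≈⟨ +-cong first (+-cong middle final) ⟩
    y ^ suc n + (0# + x ^ suc n)                    ≈⟨ +-congˡ (+-identityˡ _) ⟩
    y ^ suc n + x ^ suc n                           ≈⟨ +-comm _ _ ⟩
    x ^ suc n + y ^ suc n                           ∎
    where
    module Binomial = Algebra.Properties.CommutativeSemiring.Binomial commutativeSemiring
    t : Vector Carrier (suc (suc n))
    t = Binomial.binomialTerm x y (suc n)
    first : t zero ≈ y ^ suc n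
    first = trans (×-homo-1 _) (*-identityˡ _)
    final : last (tail t) ≈ x ^ suc n
    final rewrite toℕ-fromℕ n | nCn≡1 (suc n) | ℕₚ.n∸n≡0 n = trans (×-homo-1 _) (*-identityʳ _)
    middle : sum (init (tail t)) ≈ 0#
    middle = trans (sum-cong-≋ {n} (λ i → multiple-vanishes p≈0 (divisor i) _)) (sum-replicate-zero n)
      where
      divisor : ∀ i → suc n ∣ suc n C suc (toℕ (inject₁ i))
      divisor i = prime∣C pr (≡.subst (ℕ._< n) (≡.sym (toℕ-inject₁ i)) (toℕ<n i))

  frobenius : ∀ {p} → Prime p → p · 1# ≈ 0# → ∀ e x y →
              (x + y) ^ (p ℕ.^ e) ≈ x ^ (p ℕ.^ e) + y ^ (p ℕ.^ e)
  frobenius pr p≈0 zero x y = trans (*-identityʳ _) (sym (+-cong (*-identityʳ x) (*-identityʳ y)))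
  frobenius {p} pr p≈0 (suc e) x y = begin
    (x + y) ^ (p ℕ.* p ℕ.^ e)                               ≈⟨ ^-assocʳ (x + y) p (p ℕ.^ e) ⟨
    ((x + y) ^ p) ^ (p ℕ.^ e)                               ≈⟨ ^-congˡ (p ℕ.^ e) (freshmans-dream pr p≈0 x y) ⟩
    (x ^ p + y ^ p) ^ (p ℕ.^ e)                             ≈⟨ frobenius pr p≈0 e _ _ ⟩
    (x ^ p) ^ (p ℕ.^ e) + (y ^ p) ^ (p ℕ.^ e)               ≈⟨ +-cong (^-assocʳ x p (p ℕ.^ e)) (^-assocʳ y p (p ℕ.^ e)) ⟩
    x ^ (p ℕ.* p ℕ.^ e) + y ^ (p ℕ.* p ℕ.^ e)               ∎

-- The laws of a finite field that counting with syndromes relies on: addition is that of an abelian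
-- group, distributivity makes the multiples of a vector additive in the scalar, and cancellation
-- makes translations and nonzero scalings permutations.
record Prequasifield (q : ℕ) : Set where
  infixl 6 _⊞_
  infixl 7 _⊠_
  field
    _⊞_ _⊠_    : Fin q → Fin q → Fin q
    𝟘          : Fin q
    ⊞-assoc    : ∀ x y z → (x ⊞ y) ⊞ z ≡ x ⊞ (y ⊞ z)
    ⊞-comm     : ∀ x y → x ⊞ y ≡ y ⊞ x
    ⊞-identity : ∀ x → 𝟘 ⊞ x ≡ x
    ⊞-cancel   : ∀ x {y z} → x ⊞ y ≡ x ⊞ z → y ≡ z
    distrib    : ∀ x y z → (x ⊞ y) ⊠ z ≡ x ⊠ z ⊞ y ⊠ z
    ⊠-cancel   : ∀ x {y z} → x ≢ 𝟘 → x ⊠ y ≡ x ⊠ z → y ≡ z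

-- The polynomial T^q - T and its splitting over the integers modulo p.

module X^q-X-Polynomial (R : CommutativeRing 0ℓ 0ℓ) where

  open CommutativeRing R hiding (zero)
  open MonicPolynomials R
  open Algebra.Properties.Semiring.Mult semiring renaming (_×_ to _·_)
  open Algebra.Properties.Semiring.Exp semiring
  open IntegerSolver R using (solve; _:+_; _:*_; :-_; _:-_; _:=_; con)
  open Relation.Binary.Reasoning.Setoid setoid

  -- q = n + 2, so that the coefficient of T can be written down.
  X^q-X : ∀ n → Vec Carrier (suc (suc n))
  X^q-X n = 0# ∷ - 1# ∷ Vec.replicate n 0#

  eval-X^n : ∀ n t → eval (Vec.replicate n 0#) t ≈ t ^ n
  eval-X^n zero    t = refl
  eval-X^n (suc n) t = trans (+-identityˡ _) (*-congˡ (eval-X^n n t))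

  -- The extra factor t avoids the exponent n - 1.
  deriv-X^n : ∀ n t → t * deriv (Vec.replicate n 0#) t ≈ n · (t ^ n)
  deriv-X^n zero    t = zeroʳ t
  deriv-X^n (suc n) t = begin
    t * (eval (Vec.replicate n 0#) t + t * deriv (Vec.replicate n 0#) t)  ≈⟨ *-congˡ (+-cong (eval-X^n n t) (deriv-X^n n t)) ⟩
    t * (t ^ n + n · (t ^ n))                                     ≈⟨ distribˡ _ _ _ ⟩
    t ^ suc n + t * (n · (t ^ n))                                 ≈⟨ +-congˡ (×-comm-* n t (t ^ n)) ⟩
    suc n · (t ^ suc n)                                           ∎

  eval-X^q-X : ∀ n t → eval (X^q-X n) t ≈ t ^ suc (suc n) - t
  eval-X^q-X n t = trans (+-congˡ (*-congˡ (+-congˡ (*-congˡ (eval-X^n n t)))))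
    (solve 2 (λ t E → con (0 , 0) :+ t :* ((:- con (1 , 0)) :+ t :* E) := t :* (t :* E) :- t) refl t (t ^ n))

  -- The derivative is q T^(q-1) - 1, and q is zero in the ring.
  deriv-X^q-X : ∀ n t → suc (suc n) · 1# ≈ 0# → deriv (X^q-X n) t ≈ - 1#
  deriv-X^q-X n t q≈0 = begin
    -- The two outer factors T contribute t E each and the inner power contributes n t^(n+1), so
    -- t^(n+1) occurs n + 2 = q times.
    (- 1# + t * E) + t * (E + t * D)              ≈⟨ solve 3 (λ t E D → ((:- con (1 , 0)) :+ t :* E) :+ t :* (E :+ t :* D)
                                                       := (t :* E :+ (t :* E :+ t :* (t :* D))) :- con (1 , 0)) refl t E D ⟩
    (t * E + (t * E + t * (t * D))) - 1#          ≈⟨ +-congʳ (+-cong tE (+-cong tE (trans (*-congˡ (deriv-X^n n t)) (×-comm-* n t (t ^ n))))) ⟩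
    suc (suc n) · (t ^ suc n) - 1#                ≈⟨ +-congʳ (Characteristic.multiple-vanishes R {suc (suc n)} q≈0 {suc (suc n)} ∣-refl (t ^ suc n)) ⟩
    0# - 1#                                       ≈⟨ +-identityˡ _ ⟩
    - 1#                                          ∎
    where
    E = eval (Vec.replicate n 0#) t
    D = deriv (Vec.replicate n 0#) t
    tE : t * E ≈ t ^ suc n
    tE = *-congˡ (eval-X^n n t)

module _ {R S : CommutativeRing 0ℓ 0ℓ} where
  private
    module R = CommutativeRing R
    module S = CommutativeRing S
  open Algebra.Properties.Semiring.Mult R.semiring using () renaming (_×_ to _·R_)
  open Algebra.Properties.Semiring.Mult S.semiring using () renaming (_×_ to _·S_)

  module _ {φ : R.Carrier → S.Carrier} (hom : IsRingHomomorphism R.rawRing S.rawRing φ) where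
    open IsRingHomomorphism hom

    homo-·1 : ∀ n → φ (n ·R R.1#) S.≈ n ·S S.1#
    homo-·1 zero    = 0#-homo
    homo-·1 (suc n) = S.trans (+-homo _ _) (S.+-cong 1#-homo (homo-·1 n))

    map-X^q-X : ∀ n → Pointwise S._≈_ (Vec.map φ (X^q-X-Polynomial.X^q-X R n)) (X^q-X-Polynomial.X^q-X S n)
    map-X^q-X n = 0#-homo ∷ S.trans (-‿homo _) (S.-‿cong 1#-homo) ∷ zeros n
      where
      zeros : ∀ n → Pointwise S._≈_ (Vec.map φ (Vec.replicate n R.0#)) (Vec.replicate n S.0#)
      zeros zero    = []
      zeros (suc n) = 0#-homo ∷ zeros n

module PrimeRing (p : ℕ) where
  open import Data.Integer using (+_)
  open Ideals ℤₚ.+-*-commutativeRing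

  ℤ/p : CommutativeRing 0ℓ 0ℓ
  ℤ/p = quotient (adjoin (+ p) zeroIdeal)

  open CommutativeRing ℤ/p hiding (zero)
  open Algebra.Properties.Semiring.Mult semiring renaming (_×_ to _·_)

  ·1≡+ : ∀ n → n · 1# ≡ + n
  ·1≡+ zero    = ≡.refl
  ·1≡+ (suc n) = ≡.cong (λ z → + 1 ℤ.+ z) (·1≡+ n)

  characteristic : p · 1# ≈ 0#
  characteristic = + 1 , ≡.trans
    (≡.cong (λ z → (z ℤ.+ + 0) ℤ.- + 1 ℤ.* + p) (·1≡+ p))
    (≡.trans (≡.cong₂ (λ a b → a ℤ.- b) (ℤₚ.+-identityʳ (+ p)) (ℤₚ.*-identityˡ (+ p))) (ℤₚ.+-inverseʳ (+ p)))

  -- If 1 = r p, then absolute values force p = 1.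
  nontrivial : Prime p → ¬ 1# ≈ 0#
  nontrivial pr (r , eq) = ¬prime[1] (≡.subst Prime p≡1 pr)
    where
    1≡rp : + 1 ≡ r ℤ.* + p
    1≡rp = ℤₚ.i-j≡0⇒i≡j (+ 1) (r ℤ.* + p) eq
    p≡1 : p ≡ 1
    p≡1 = ℕₚ.m*n≡1⇒n≡1 ℤ.∣ r ∣ p (≡.sym (≡.trans (≡.cong ℤ.∣_∣ 1≡rp) (ℤₚ.abs-* r (+ p))))

record SplitsX^q-X (p n : ℕ) : Set₁ where
  field
    R : CommutativeRing 0ℓ 0ℓ
  open CommutativeRing R
  open Algebra.Properties.Semiring.Mult semiring renaming (_×_ to _·_)
  field
    1≉0    : ¬ 1# ≈ 0#
    p≈0    : p · 1# ≈ 0#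
    roots  : Vec Carrier (suc (suc n))
    splits : Pointwise _≈_ (X^q-X-Polynomial.X^q-X R n) (MonicPolynomials.fromRoots R roots)

splitting⇒SplitsX^q-X : ∀ {p n} (K : CommutativeRing 0ℓ 0ℓ) → let open CommutativeRing K in
  Algebra.Properties.Semiring.Mult._×_ semiring p 1# ≈ 0# → SplittingRing K (X^q-X-Polynomial.X^q-X K n) → SplitsX^q-X p n
splitting⇒SplitsX^q-X {p} {n} K p≈0 S = record
  { R = overring
  ; 1≉0 = nontrivial
  ; p≈0 = trans (sym (homo-·1 {K} {overring} isHom p)) (trans (⟦⟧-cong p≈0) 0#-homo)
  ; roots = roots
  ; splits = Pointwise.trans trans (Pointwise.sym sym (map-X^q-X {K} {overring} isHom n)) splits
  }
  where
  open SplittingRing S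
  open CommutativeRing overring using (trans; sym)
  open IsRingHomomorphism isHom using (⟦⟧-cong; 0#-homo)

splitX^q-X : ∀ {p} → Prime p → ∀ n → SplitsX^q-X p n
splitX^q-X {p} pr n = splitting⇒SplitsX^q-X ℤ/p characteristic (splittingRing ℤ/p (nontrivial pr) (X^q-X-Polynomial.X^q-X ℤ/p n))
  where open PrimeRing p

-- Fixed points of the q-th power map and the field they form modulo a suitable ideal.

module FixedPoints {p e n : ℕ} (pr : Prime p) (q≡ : suc (suc n) ≡ p ℕ.^ suc e) (split : SplitsX^q-X p n) where

  private
    q : ℕ
    q = suc (suc n)

  open SplitsX^q-X split
  open CommutativeRing R hiding (zero)
  open Algebra.Properties.Semiring.Mult semiring renaming (_×_ to _·_)
  open MonicPolynomials R
  open X^q-X-Polynomial R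
  open Ideals R
  open Characteristic R
  open Algebra.Properties.Semiring.Exp semiring
  open Algebra.Properties.CommutativeSemiring.Exp commutativeSemiring using (^-distrib-*)
  open IntegerSolver R using (solve; _:+_; _:*_; :-_; _:-_; _:=_; con)
  open Relation.Binary.Reasoning.Setoid setoid

  α : Fin q → Carrier
  α = lookup roots

  q≈0 : q · 1# ≈ 0#
  q≈0 = multiple-vanishes p≈0 (≡.subst (p ∣_) (≡.sym q≡) (m∣m*n (p ℕ.^ e))) 1#

  -- The derivative of T^q - T at αᵢ is -1, and it is also a multiple of αᵢ - αⱼ.
  separable : ∀ i j → i ≢ j → ∃ λ r → 1# ≈ r * (α i - α j)
  separable i j i≢j = - r , (begin
    1#                            ≈⟨ solve 0 (con (1 , 0) := :- (:- con (1 , 0))) refl ⟩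
    - - 1#                        ≈⟨ -‿cong (deriv-X^q-X n (α i) q≈0) ⟨
    - deriv (X^q-X n) (α i)       ≈⟨ -‿cong (trans (deriv-cong (α i) splits) (proj₂ divisible)) ⟩
    - (r * (α i - α j))           ≈⟨ solve 2 (λ r x → :- (r :* x) := (:- r) :* x) refl r (α i - α j) ⟩
    - r * (α i - α j)             ∎)
    where
    divisible = deriv-divisible roots i j i≢j
    r = proj₁ divisible

  Fixed : Carrier → Set
  Fixed x = x ^ q ≈ x

  Fixed-+ : ∀ {x y} → Fixed x → Fixed y → Fixed (x + y)
  Fixed-+ {x} {y} hx hy = begin
    (x + y) ^ q        ≈⟨ frobenius-q x y ⟩
    x ^ q + y ^ q      ≈⟨ +-cong hx hy ⟩
    x + y              ∎
    where
    frobenius-q : ∀ x y → (x + y) ^ q ≈ x ^ q + y ^ q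
    frobenius-q x y = ≡.subst (λ m → (x + y) ^ m ≈ x ^ m + y ^ m) (≡.sym q≡) (frobenius pr p≈0 (suc e) x y)

  Fixed-* : ∀ {x y} → Fixed x → Fixed y → Fixed (x * y)
  Fixed-* {x} {y} hx hy = trans (^-distrib-* x y q) (*-cong hx hy)

  Fixed-0 : Fixed 0#
  Fixed-0 = zeroˡ _

  eval-fromRoots : ∀ x → eval (fromRoots roots) x ≈ x ^ q - x
  eval-fromRoots x = trans (sym (eval-cong x splits)) (eval-X^q-X n x)

  Fixed-α : ∀ i → Fixed (α i)
  Fixed-α i = begin
    α i ^ q                    ≈⟨ solve 2 (λ x y → x := (x :- y) :+ y) refl (α i ^ q) (α i) ⟩
    (α i ^ q - α i) + α i      ≈⟨ +-congʳ (trans (sym (eval-fromRoots (α i))) (eval-root roots i)) ⟩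
    0# + α i                   ≈⟨ +-identityˡ _ ⟩
    α i                        ∎

  factors : ∀ {m} → Carrier → Vec Carrier m → List Carrier
  factors x []       = []
  factors x (a ∷ as) = x - a ∷ factors x as

  Π-factors : ∀ {m} x (as : Vec Carrier m) → Π (factors x as) ≈ eval (fromRoots as) x
  Π-factors x []       = refl
  Π-factors x (a ∷ as) = trans (*-congˡ (Π-factors x as)) (sym (eval-fromRoots-∷ a as x))

  Any-factors : ∀ {m x} {P : Carrier → Set} (as : Vec Carrier m) → Any P (factors x as) → ∃ λ i → P (x - lookup as i)
  Any-factors (a ∷ as) (here h)  = zero , h
  Any-factors (a ∷ as) (there h) with Any-factors as h
  ... | i , h′ = suc i , h′

  -- The product of all x - αᵢ equals x^q - x, which vanishes already in R. It is stated as
  -- membership in I to serve as input to `adjoin-factor`.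
  Fixed⇒Π∈ : ∀ I {x} → Fixed x → Ideal._∈I I (Π (factors x roots))
  Fixed⇒Π∈ I {x} hx = resp (sym (begin
    Π (factors x roots)          ≈⟨ Π-factors x roots ⟩
    eval (fromRoots roots) x     ≈⟨ eval-fromRoots x ⟩
    x ^ q - x                      ≈⟨ +-congʳ hx ⟩
    x - x                          ≈⟨ -‿inverseʳ x ⟩
    0#                             ∎)) 0∈
    where open Ideal I

  -- A proper ideal modulo which every element of xs becomes one of the roots.
  record Specialisation (xs : List (Σ Carrier Fixed)) : Set₁ where
    field
      ideal   : Ideal
      proper  : Proper ideal
      rooted  : ∀ {x} → x ∈ xs → ∃ λ i → Ideal._∈I ideal (proj₁ x - α i)

  -- One element is treated at a time, by adjoining x - αᵢ for some factor that keeps the ideal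
  -- proper. The ideal only grows, so earlier identifications persist.
  specialise : ∀ xs → ¬ ¬ Specialisation xs
  specialise [] none = none (record { ideal = zeroIdeal ; proper = 1≉0 ; rooted = λ () })
  specialise ((x , hx) ∷ xs) none = specialise xs λ σ → let open Specialisation σ in
    adjoin-factor ideal proper (factors x roots) (Fixed⇒Π∈ ideal hx) λ some →
    let i , proper′ = Any-factors roots some in
    none (record
      { ideal = adjoin (x - α i) ideal
      ; proper = proper′
      ; rooted = λ
        { (here ≡.refl) → i , ∈-adjoin (x - α i) ideal
        ; (there x∈)    → let j , h = rooted x∈ in j , ⊆-adjoin (x - α i) ideal h
        }
      })

  sums products targets : List (Σ Carrier Fixed)
  sums     = cartesianProductWith (λ i j → α i + α j , Fixed-+ (Fixed-α i) (Fixed-α j)) (allFin q) (allFin q)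
  products = cartesianProductWith (λ i j → α i * α j , Fixed-* (Fixed-α i) (Fixed-α j)) (allFin q) (allFin q)
  targets  = (0# , Fixed-0) ∷ sums ++ products

  module Tables (σ : Specialisation targets) where
    open Specialisation σ
    open Ideal ideal
    module Q = CommutativeRing (quotient ideal)

    zero-rooted : ∃ λ i → 0# Q.≈ α i
    zero-rooted = rooted {0# , Fixed-0} (here ≡.refl)

    plus : ∀ i j → ∃ λ k → α i + α j Q.≈ α k
    plus i j = rooted (there (∈-++⁺ˡ (∈-cartesianProductWith⁺ _ (∈-allFin i) (∈-allFin j))))

    times : ∀ i j → ∃ λ k → α i * α j Q.≈ α k
    times i j = rooted (there (∈-++⁺ʳ sums (∈-cartesianProductWith⁺ _ (∈-allFin i) (∈-allFin j))))

    -- Roots with distinct indices differ by a unit, and a proper ideal contains no unit.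
    α-injective : ∀ {i j} → α i Q.≈ α j → i ≡ j
    α-injective {i} {j} h = decidable-stable (i ≟ᶠ j) λ i≢j →
      proper (resp (sym (proj₂ (separable i j i≢j))) (*-closed _ h))

    -- The tables are read off in the quotient ring, and `α-injective` transports each of its laws
    -- back to the indices.
    prequasifield : Prequasifield q
    prequasifield = record
      { _⊞_ = λ i j → proj₁ (plus i j)
      ; _⊠_ = λ i j → proj₁ (times i j)
      ; 𝟘 = proj₁ zero-rooted
      ; ⊞-assoc = λ x y z → α-injective (Q.trans (Q.sym (proj₂ (plus _ z)))
          (Q.trans (Q.+-congʳ (Q.sym (proj₂ (plus x y)))) (Q.trans (Q.+-assoc _ _ _)
          (Q.trans (Q.+-congˡ (proj₂ (plus y z))) (proj₂ (plus x _))))))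
      ; ⊞-comm = λ x y → α-injective (Q.trans (Q.sym (proj₂ (plus x y))) (Q.trans (Q.+-comm _ _) (proj₂ (plus y x))))
      ; ⊞-identity = λ x → α-injective (Q.trans (Q.sym (proj₂ (plus _ x)))
          (Q.trans (Q.+-congʳ (Q.sym (proj₂ zero-rooted))) (Q.+-identityˡ _)))
      ; ⊞-cancel = λ x {y} {z} eq → α-injective (+-cancelˡ (α x) (α y) (α z)
          (Q.trans (proj₂ (plus x y)) (Q.trans (Q.reflexive (≡.cong α eq)) (Q.sym (proj₂ (plus x z))))))
      ; distrib = λ x y z → α-injective (Q.trans (Q.sym (proj₂ (times _ z)))
          (Q.trans (Q.*-congʳ (Q.sym (proj₂ (plus x y)))) (Q.trans (Q.distribʳ _ _ _)
          (Q.trans (Q.+-cong (proj₂ (times x z)) (proj₂ (times y z))) (proj₂ (plus _ _))))))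
      ; ⊠-cancel = λ x {y} {z} x≢0 eq → α-injective (*-cancel x x≢0
          (Q.trans (proj₂ (times x y)) (Q.trans (Q.reflexive (≡.cong α eq)) (Q.sym (proj₂ (times x z))))))
      }
      where
      open GroupProperties (CommutativeRing.+-group (quotient ideal)) using (ε⁻¹≈ε) renaming (∙-cancelˡ to +-cancelˡ)
      -- Since α z is zero in the quotient, the unit α x - α z equals α x there, so the multiplier
      -- `r` is an inverse of α x.
      *-cancel : ∀ x {u v} → x ≢ proj₁ zero-rooted → α x * u Q.≈ α x * v → u Q.≈ v
      *-cancel x {u} {v} x≢0 h = Q.trans (Q.sym (recover u)) (Q.trans (Q.*-congˡ h) (recover v))
        where
        z = proj₁ zero-rooted
        r = proj₁ (separable x z x≢0)
        α-0 : α x - α z Q.≈ α x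
        α-0 = Q.trans (Q.+-congˡ (Q.-‿cong (Q.sym (proj₂ zero-rooted)))) (Q.trans (Q.+-congˡ ε⁻¹≈ε) (Q.+-identityʳ _))
        recover : ∀ w → r * (α x * w) Q.≈ w
        recover w = Q.trans (Q.sym (Q.*-assoc r (α x) w)) (Q.trans (Q.*-congʳ
          (Q.trans (Q.*-congˡ (Q.sym α-0)) (Q.sym (≈⇒-∈ ideal (proj₂ (separable x z x≢0)))))) (Q.*-identityˡ w))

  ¬¬prequasifield : ¬ ¬ Prequasifield q
  ¬¬prequasifield none = specialise targets λ σ → none (Tables.prequasifield σ)

-- Finite sums over symbols and lists.

open import Algebra.Properties.Semiring.Sum ℕₚ.+-*-semiring using (sum-cong-≗; sum-remove; ∑-distrib-+; ∑-comm; sum-permute; *-distribˡ-sum) renaming (sum to ∑)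
open import Data.Bool using (true; false; if_then_else_)
open import Data.List using (map; concatMap; filter; length; concat; replicate)
open import Data.List.Properties using (map-∘; map-++; map-cong; map-tabulate; length-map; length-++; length-replicate)
open import Data.Nat using (_+_; _*_; _∸_; _^_; _≤_; _≤?_; _⊓_; s≤s⁻¹; NonZero; >-nonZero)
open import Data.Nat.Coprimality using (Coprime; coprime-divisor)
open import Data.Nat.ListAction using (sum)
open import Data.Nat.ListAction.Properties using (sum-++)
open import Data.Nat.Properties using (_≟_; +-identityʳ; +-assoc; +-cancelʳ-≡; +-cancelʳ-≤; +-monoʳ-≤; *-comm; *-assoc; *-identityʳ; *-cancelˡ-≤; *-cancelʳ-≤; m⊓n≤m; m⊓n+n∸m≡n; m≤n+o⇒m∸n≤o; m+[n∸m]≡n; m*n≡1⇒m≡1; m^n≡0⇒m≡0; 1+n≰n; ≤-antisym; ≤-reflexive; ≤-trans; module ≤-Reasoning)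
open import Function.Bundles using (_⇔_; mk⇔)
open import Relation.Binary.PropositionalEquality using (refl; sym; trans; cong; cong₂; subst; module ≡-Reasoning)
open import Relation.Unary using (Decidable)
import Data.List as List

-- If y were missed, removing y from the codomain would inject n + 1 elements into n.
injective⇒surjective : ∀ {n} (π : Fin n → Fin n) → (∀ {x y} → π x ≡ π y → x ≡ y) → ∀ y → ∃ λ x → π x ≡ y
injective⇒surjective {suc n} π inj y with any? (λ x → π x ≟ᶠ y)
... | yes hit = hit
... | no miss = ⊥-elim (1+n≰n (injective⇒≤ {f = λ x → punchOut (avoid x)} λ eq → inj (punchOut-injective (avoid _) (avoid _) eq)))
  where
  avoid : ∀ x → y ≢ π x
  avoid x eq = miss (x , sym eq)

∑-reindex : ∀ {n} (π : Fin n → Fin n) → (∀ {x y} → π x ≡ π y → x ≡ y) → ∀ f → ∑ (λ x → f (π x)) ≡ ∑ f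
∑-reindex π inj f = sym (sum-permute f (permutation π (proj₁ ∘ onto) (proj₂ ∘ onto) (λ x → inj (proj₂ (onto (π x))))))
  where onto = injective⇒surjective π inj

-- The summands at y are exchanged additively, which avoids truncated subtraction.
∑-agree-off : ∀ {n} (f g : Fin n → ℕ) y → (∀ x → x ≢ y → f x ≡ g x) → ∑ f + g y ≡ ∑ g + f y
∑-agree-off {suc n} f g y agree = begin
  ∑ f + g y                          ≡⟨ cong (_+ g y) (sum-remove {i = y} f) ⟩
  f y + ∑ (f ∘ punchIn y) + g y      ≡⟨ cong (λ s → f y + s + g y) (sum-cong-≗ {n} λ i → agree (punchIn y i) (punchInᵢ≢i y i)) ⟩
  f y + ∑ (g ∘ punchIn y) + g y      ≡⟨ solve 3 (λ a b c → a :+ b :+ c := c :+ b :+ a) refl (f y) (∑ (g ∘ punchIn y)) (g y) ⟩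
  g y + ∑ (g ∘ punchIn y) + f y      ≡⟨ cong (_+ f y) (sum-remove {i = y} g) ⟨
  ∑ g + f y                          ∎
  where
  open ≡-Reasoning
  open +-*-Solver

∑-const : ∀ n c → ∑ {n} (λ _ → c) ≡ n * c
∑-const zero    c = refl
∑-const (suc n) c = cong (c +_) (∑-const n c)

sum-map-allFin : ∀ {n} (f : Fin n → ℕ) → sum (map f (allFin n)) ≡ ∑ f
sum-map-allFin f = trans (cong sum (map-tabulate (λ x → x) f)) (sum-tabulate f)
  where
  sum-tabulate : ∀ {n} (f : Fin n → ℕ) → sum (List.tabulate f) ≡ ∑ f
  sum-tabulate {zero}  f = refl
  sum-tabulate {suc n} f = cong (f zero +_) (sum-tabulate (f ∘ suc))

sum-map-concatMap : ∀ {A B : Set} (f : B → ℕ) (g : A → List B) xs →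
                    sum (map f (concatMap g xs)) ≡ sum (map (λ x → sum (map f (g x))) xs)
sum-map-concatMap f g []       = refl
sum-map-concatMap f g (x ∷ xs) = begin
  sum (map f (g x ++ concatMap g xs))                 ≡⟨ cong sum (map-++ f (g x) (concatMap g xs)) ⟩
  sum (map f (g x) ++ map f (concatMap g xs))         ≡⟨ sum-++ (map f (g x)) _ ⟩
  sum (map f (g x)) + sum (map f (concatMap g xs))    ≡⟨ cong (sum (map f (g x)) +_) (sum-map-concatMap f g xs) ⟩
  sum (map f (g x)) + sum (map (λ x → sum (map f (g x))) xs) ∎
  where open ≡-Reasoning

sum-map-filter : ∀ {A : Set} {P : A → Set} (P? : Decidable P) (f : A → ℕ) xs →
                 sum (map f (filter P? xs)) ≡ sum (map (λ x → if does (P? x) then f x else 0) xs)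
sum-map-filter P? f []       = refl
sum-map-filter P? f (x ∷ xs) with does (P? x)
... | true  = cong (f x +_) (sum-map-filter P? f xs)
... | false = sum-map-filter P? f xs

-- Sums over all vertices

∑ᵛ : ∀ {q} d → (Vertex q d → ℕ) → ℕ
∑ᵛ zero    f = f []
∑ᵛ (suc d) f = ∑ λ x → ∑ᵛ d λ u → f (x ∷ u)

∑ᵛ-cong : ∀ {q} d {f g : Vertex q d → ℕ} → (∀ u → f u ≡ g u) → ∑ᵛ d f ≡ ∑ᵛ d g
∑ᵛ-cong zero    h = h []
∑ᵛ-cong {q} (suc d) h = sum-cong-≗ {q} λ x → ∑ᵛ-cong d λ u → h (x ∷ u)

∑ᵛ-+ : ∀ {q} d (f g : Vertex q d → ℕ) → ∑ᵛ d (λ u → f u + g u) ≡ ∑ᵛ d f + ∑ᵛ d g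
∑ᵛ-+ zero    f g = refl
∑ᵛ-+ {q} (suc d) f g = trans (sum-cong-≗ {q} λ x → ∑ᵛ-+ d _ _) (∑-distrib-+ {q} _ _)

∑ᵛ-const : ∀ q d c → ∑ᵛ {q} d (λ _ → c) ≡ q ^ d * c
∑ᵛ-const q zero    c = sym (+-identityʳ c)
∑ᵛ-const q (suc d) c = begin
  ∑ {q} (λ _ → ∑ᵛ d (λ _ → c))   ≡⟨ sum-cong-≗ {q} (λ _ → ∑ᵛ-const q d c) ⟩
  ∑ {q} (λ _ → q ^ d * c)        ≡⟨ ∑-const q (q ^ d * c) ⟩
  q * (q ^ d * c)                ≡⟨ solve 3 (λ q r c → q :* (r :* c) := q :* r :* c) refl q (q ^ d) c ⟩
  q ^ suc d * c                  ∎
  where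
  open ≡-Reasoning
  open +-*-Solver

∑ᵛ-∑ : ∀ {q n} d (f : Vertex q d → Fin n → ℕ) → ∑ᵛ d (λ u → ∑ (f u)) ≡ ∑ (λ i → ∑ᵛ d λ u → f u i)
∑ᵛ-∑ zero    f = refl
∑ᵛ-∑ {q} {n} (suc d) f = trans (sum-cong-≗ {q} λ x → ∑ᵛ-∑ d (λ u → f (x ∷ u))) (∑-comm {q} {n} λ x i → ∑ᵛ d λ u → f (x ∷ u) i)

sum-allVertices : ∀ q d (f : Vertex q d → ℕ) → sum (map f (allVertices q d)) ≡ ∑ᵛ d f
sum-allVertices q zero    f = +-identityʳ (f [])
sum-allVertices q (suc d) f = begin
  sum (map f (concatMap (λ x → map (x ∷_) (allVertices q d)) (allFin q)))      ≡⟨ sum-map-concatMap f _ (allFin q) ⟩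
  sum (map (λ x → sum (map f (map (x ∷_) (allVertices q d)))) (allFin q))      ≡⟨ sum-map-allFin {q} _ ⟩
  ∑ (λ x → sum (map f (map (x ∷_) (allVertices q d))))                         ≡⟨ sum-cong-≗ {q} (λ x → cong sum (sym (map-∘ (allVertices q d)))) ⟩
  ∑ (λ x → sum (map (λ u → f (x ∷ u)) (allVertices q d)))                      ≡⟨ sum-cong-≗ {q} (λ x → sum-allVertices q d _) ⟩
  ∑ (λ x → ∑ᵛ d λ u → f (x ∷ u))                                               ∎
  where open ≡-Reasoning

-- Sums over closed neighbourhoods

∑-ball : ∀ {q} d → ℕ → (Vertex q d → ℕ) → Vertex q d → ℕ
∑-ball d r f v = ∑ᵛ d λ u → if does (hamming u v ≤? r) then f u else 0

sumClosedNbhd≡∑-ball : ∀ q d f v → sumClosedNbhd q d f v ≡ ∑-ball d 1 f v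
sumClosedNbhd≡∑-ball q d f v = trans (sum-map-filter (λ u → hamming u v ≤? 1) f (allVertices q d)) (sum-allVertices q d _)

hamming-≡ : ∀ {q d} x (u v : Vertex q d) → hamming (x ∷ u) (x ∷ v) ≡ hamming u v
hamming-≡ x u v with x ≟ᶠ x
... | yes _  = refl
... | no x≢x = ⊥-elim (x≢x refl)

hamming-≢ : ∀ {q d} {x y} (u v : Vertex q d) → x ≢ y → hamming (x ∷ u) (y ∷ v) ≡ suc (hamming u v)
hamming-≢ {x = x} {y} u v x≢y with x ≟ᶠ y
... | yes x≡y = ⊥-elim (x≢y x≡y)
... | no _    = refl

-- A first coordinate x ≠ y uses up one unit of distance, and g x is what then remains of the ball;
-- the layer x = y keeps the full radius. The sum of g also counts x = y, whence g y on the left.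
∑-ball-∷ : ∀ {q d} r (f : Vertex q (suc d) → ℕ) y v {g : Fin q → ℕ} →
  (∀ x → x ≢ y → ∑ᵛ d (λ u → if does (suc (hamming u v) ≤? r) then f (x ∷ u) else 0) ≡ g x) →
  ∑-ball (suc d) r f (y ∷ v) + g y ≡ ∑ g + ∑-ball d r (f ∘ (y ∷_)) v
∑-ball-∷ {q} {d} r f y v {g} off = trans
  (∑-agree-off _ g y λ x x≢y → trans (∑ᵛ-cong d λ u → cong (λ h → if does (h ≤? r) then f (x ∷ u) else 0) (hamming-≢ u v x≢y)) (off x x≢y))
  (cong (∑ g +_) (∑ᵛ-cong d λ u → cong (λ h → if does (h ≤? r) then f (y ∷ u) else 0) (hamming-≡ y u v)))

∑-ball-0 : ∀ {q} d (f : Vertex q d → ℕ) v → ∑-ball d 0 f v ≡ f v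
∑-ball-0 zero f [] = refl
∑-ball-0 {q} (suc d) f (y ∷ v) = begin
  ∑-ball (suc d) 0 f (y ∷ v)             ≡⟨ +-identityʳ _ ⟨
  ∑-ball (suc d) 0 f (y ∷ v) + 0         ≡⟨ ∑-ball-∷ 0 f y v {λ _ → 0} (λ x _ → ∑ᵛ-0 q d) ⟩
  ∑ {q} (λ _ → 0) + ∑-ball d 0 (f ∘ (y ∷_)) v   ≡⟨ cong₂ _+_ (trans (∑-const q 0) (*-comm q 0)) (∑-ball-0 d _ v) ⟩
  f (y ∷ v)                              ∎
  where
  open ≡-Reasoning
  ∑ᵛ-0 : ∀ q d → ∑ᵛ {q} d (λ _ → 0) ≡ 0
  ∑ᵛ-0 q d = trans (∑ᵛ-const q d 0) (*-comm (q ^ d) 0)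

-- The closed neighbourhood of y ∷ v is the line through it in the first direction together with the
-- neighbourhood of v inside layer y. The vertex itself lies in both, which accounts for the extra
-- summand.
∑-ball-1-∷ : ∀ {q} d (f : Vertex q (suc d) → ℕ) y v →
  ∑-ball (suc d) 1 f (y ∷ v) + f (y ∷ v) ≡ ∑ (λ x → f (x ∷ v)) + ∑-ball d 1 (f ∘ (y ∷_)) v
∑-ball-1-∷ d f y v = ∑-ball-∷ 1 f y v {λ x → f (x ∷ v)} λ x _ → trans
  (∑ᵛ-cong d λ u → cong (λ b → if b then f (x ∷ u) else 0) (does-suc (hamming u v))) (∑-ball-0 d (f ∘ (x ∷_)) v)
  where
  does-suc : ∀ h → does (suc h ≤? 1) ≡ does (h ≤? 0)
  does-suc zero    = refl
  does-suc (suc h) = refl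

-- Double counting: with q + 1 symbols, every vertex lies in exactly q d + 1 closed neighbourhoods.
∑ᵛ-∑-ball : ∀ {q} d (f : Vertex (suc q) d → ℕ) → ∑ᵛ d (∑-ball d 1 f) ≡ (q * d + 1) * ∑ᵛ d f
∑ᵛ-∑-ball {q} zero f = begin
  f []                   ≡⟨ solve 2 (λ q x → x := (q :* con 0 :+ con 1) :* x) refl q (f []) ⟩
  (q * 0 + 1) * f []     ∎
  where
  open ≡-Reasoning
  open +-*-Solver
∑ᵛ-∑-ball {q} (suc d) f = +-cancelʳ-≡ T _ _ (begin
  ∑ᵛ (suc d) (∑-ball (suc d) 1 f) + T                              ≡⟨ ∑ᵛ-+ (suc d) (∑-ball (suc d) 1 f) f ⟨
  ∑ᵛ (suc d) (λ v → ∑-ball (suc d) 1 f v + f v)                    ≡⟨ ∑ᵛ-cong (suc d) {λ v → ∑-ball (suc d) 1 f v + f v} {step} (λ { (y ∷ v) → ∑-ball-1-∷ d f y v }) ⟩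
  ∑ᵛ (suc d) step                                                  ≡⟨ ∑ᵛ-+ (suc d) line rest ⟩
  ∑ᵛ (suc d) line + ∑ᵛ (suc d) rest                                ≡⟨ cong₂ _+_ lines rests ⟩
  suc q * T + (q * d + 1) * T                                      ≡⟨ solve 3 (λ q d T → (con 1 :+ q) :* T :+ (q :* d :+ con 1) :* T
                                                                        := (q :* (con 1 :+ d) :+ con 1) :* T :+ T) refl q d T ⟩
  (q * suc d + 1) * T + T                                          ∎)
  where
  open ≡-Reasoning
  open +-*-Solver
  T = ∑ᵛ (suc d) f
  line rest step : Vertex (suc q) (suc d) → ℕ
  line (y ∷ v) = ∑ λ x → f (x ∷ v)
  rest (y ∷ v) = ∑-ball d 1 (f ∘ (y ∷_)) v
  step v = line v + rest v
  lines : ∑ᵛ (suc d) line ≡ suc q * T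
  lines = trans (∑-const (suc q) (∑ᵛ d λ v → ∑ λ x → f (x ∷ v))) (cong (suc q *_) (∑ᵛ-∑ d λ v x → f (x ∷ v)))
  rests : ∑ᵛ (suc d) rest ≡ (q * d + 1) * T
  rests = trans (sum-cong-≗ {suc q} λ y → ∑ᵛ-∑-ball d (f ∘ (y ∷_)))
    (sym (*-distribˡ-sum {suc q} (q * d + 1) λ y → ∑ᵛ d (f ∘ (y ∷_))))

-- Lines in 𝔽^a and sums over syndromes.

module LinearCodes {q : ℕ} (𝔽 : Prequasifield q) where
  open Prequasifield 𝔽

  infixl 6 _⊕_
  _⊕_ : ∀ {a} → Vertex q a → Vertex q a → Vertex q a
  _⊕_ = zipWith _⊞_

  𝟎 : ∀ {a} → Vertex q a
  𝟎 {a} = Vec.replicate a 𝟘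

  ⊕-assoc : ∀ {a} (u v w : Vertex q a) → (u ⊕ v) ⊕ w ≡ u ⊕ (v ⊕ w)
  ⊕-assoc = zipWith-assoc ⊞-assoc

  ⊕-comm : ∀ {a} (u v : Vertex q a) → u ⊕ v ≡ v ⊕ u
  ⊕-comm = zipWith-comm ⊞-comm

  ⊕-identityˡ : ∀ {a} (u : Vertex q a) → 𝟎 ⊕ u ≡ u
  ⊕-identityˡ = zipWith-identityˡ ⊞-identity

  ⊕-identityʳ : ∀ {a} (u : Vertex q a) → u ⊕ 𝟎 ≡ u
  ⊕-identityʳ u = trans (⊕-comm u 𝟎) (⊕-identityˡ u)

  ⊠-zeroˡ : ∀ x → 𝟘 ⊠ x ≡ 𝟘
  ⊠-zeroˡ x = ⊞-cancel (𝟘 ⊠ x) (begin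
    𝟘 ⊠ x ⊞ 𝟘 ⊠ x   ≡⟨ distrib 𝟘 𝟘 x ⟨
    (𝟘 ⊞ 𝟘) ⊠ x     ≡⟨ cong (_⊠ x) (⊞-identity 𝟘) ⟩
    𝟘 ⊠ x           ≡⟨ ⊞-identity (𝟘 ⊠ x) ⟨
    𝟘 ⊞ 𝟘 ⊠ x       ≡⟨ ⊞-comm 𝟘 (𝟘 ⊠ x) ⟩
    𝟘 ⊠ x ⊞ 𝟘       ∎)
    where open ≡-Reasoning

  scale : ∀ {a} → Fin q → Vertex q a → Vertex q a
  scale c = Vec.map (c ⊠_)

  scale-⊞ : ∀ {a} c c′ (u : Vertex q a) → scale (c ⊞ c′) u ≡ scale c u ⊕ scale c′ u
  scale-⊞ c c′ []      = refl
  scale-⊞ c c′ (x ∷ u) = cong₂ _∷_ (distrib c c′ x) (scale-⊞ c c′ u)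

  scale-𝟘 : ∀ {a} (u : Vertex q a) → scale 𝟘 u ≡ 𝟎
  scale-𝟘 []      = refl
  scale-𝟘 (x ∷ u) = cong₂ _∷_ (⊠-zeroˡ x) (scale-𝟘 u)

  ∑ᵛ-translate : ∀ {a} g (F : Vertex q a → ℕ) → ∑ᵛ a (λ w → F (g ⊕ w)) ≡ ∑ᵛ a F
  ∑ᵛ-translate []      F = refl
  ∑ᵛ-translate (x ∷ g) F = trans (sum-cong-≗ {q} λ y → ∑ᵛ-translate g (λ w → F ((x ⊞ y) ∷ w)))
    (∑-reindex (x ⊞_) (⊞-cancel x) (λ y → ∑ᵛ _ λ w → F (y ∷ w)))

  ∑ᵛ-scale : ∀ a {c} → c ≢ 𝟘 → (F : Vertex q a → ℕ) → ∑ᵛ a (λ w → F (scale c w)) ≡ ∑ᵛ a F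
  ∑ᵛ-scale zero    c≢0 F = refl
  ∑ᵛ-scale (suc a) {c} c≢0 F = trans (sum-cong-≗ {q} λ y → ∑ᵛ-scale a c≢0 (λ w → F ((c ⊠ y) ∷ w)))
    (∑-reindex (c ⊠_) (⊠-cancel c c≢0) (λ y → ∑ᵛ _ λ w → F (y ∷ w)))

  -- A column h matters only through its multiples c h, so it is stored as the additive map sending
  -- c to c h. The zero entries of a column then call for no law about products with 𝟘 on the right.
  record Column (a : ℕ) : Set where
    field
      multiple : Fin q → Vertex q a
      additive : ∀ x y → multiple (x ⊞ y) ≡ multiple x ⊕ multiple y
  open Column

  zeroColumn : ∀ {a} → Column a
  zeroColumn = record { multiple = λ _ → 𝟎 ; additive = λ _ _ → sym (⊕-identityˡ 𝟎) }

  horizontal : ∀ {a} → Column a → Column (suc a)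
  horizontal h = record
    { multiple = λ c → 𝟘 ∷ multiple h c
    ; additive = λ x y → cong₂ _∷_ (sym (⊞-identity 𝟘)) (additive h x y)
    }

  slope : ∀ {a} → Vertex q a → Column (suc a)
  slope u = record
    { multiple = λ c → c ∷ scale c u
    ; additive = λ x y → cong₂ _∷_ refl (scale-⊞ x y u)
    }

  -- One column through each line of 𝔽^a.
  points : ∀ a → List (Column a)
  points zero    = []
  points (suc a) = map horizontal (points a) ++ map slope (allVertices q a)

  length-allVertices : ∀ a → length (allVertices q a) ≡ q ^ a
  length-allVertices a = begin
    length (allVertices q a)                   ≡⟨ length≡sum (allVertices q a) ⟩
    sum (map (λ _ → 1) (allVertices q a))      ≡⟨ sum-allVertices q a (λ _ → 1) ⟩
    ∑ᵛ {q} a (λ _ → 1)                         ≡⟨ ∑ᵛ-const q a 1 ⟩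
    q ^ a * 1                                  ≡⟨ *-identityʳ (q ^ a) ⟩
    q ^ a                                      ∎
    where
    open ≡-Reasoning
    length≡sum : ∀ {A : Set} (xs : List A) → length xs ≡ sum (map (λ _ → 1) xs)
    length≡sum []       = refl
    length≡sum (_ ∷ xs) = cong suc (length≡sum xs)

  length-points : ∀ a → length (points (suc a)) ≡ length (points a) + q ^ a
  length-points a = trans (length-++ (map horizontal (points a)))
    (cong₂ _+_ (length-map horizontal (points a)) (trans (length-map slope (allVertices q a)) (length-allVertices a)))

  -- The lines through the origin partition the nonzero vectors, and each of them contains 𝟎. Thus 𝟎
  -- is counted once per line, and the separate F 𝟎 completes the sum over all vectors.
  sum-points : ∀ a (F : Vertex q a → ℕ) →
    F 𝟎 + sum (map (λ h → ∑ (λ c → F (multiple h c))) (points a)) ≡ ∑ᵛ a F + length (points a) * F 𝟎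
  sum-points zero    F = refl
  sum-points (suc a) F = begin
    F₀ + sum (map onLine (map horizontal (points a) ++ map slope (allVertices q a)))  ≡⟨ cong (F₀ +_) split ⟩
    F₀ + (A + ∑ K)                                    ≡⟨ +-assoc F₀ A (∑ K) ⟨
    F₀ + A + ∑ K                                      ≡⟨ cong (_+ ∑ K) (sum-points a (λ w → F (𝟘 ∷ w))) ⟩
    L 𝟘 + P * F₀ + ∑ K                                ≡⟨ solve 3 (λ x y z → x :+ y :+ z := z :+ x :+ y) refl (L 𝟘) (P * F₀) (∑ K) ⟩
    -- For c ≠ 𝟘 scaling by c permutes the slopes, so the sloped lines meet layer c in each vector
    -- once; in layer 𝟘 all of them meet at 𝟎.
    ∑ K + L 𝟘 + P * F₀                                ≡⟨ cong (_+ P * F₀) (∑-agree-off K L 𝟘 λ c c≢0 → ∑ᵛ-scale a c≢0 (λ w → F (c ∷ w))) ⟩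
    ∑ L + K 𝟘 + P * F₀                                ≡⟨ cong (λ k → ∑ L + k + P * F₀) K𝟘 ⟩
    ∑ L + q ^ a * F₀ + P * F₀                         ≡⟨ solve 4 (λ l r p f → l :+ r :* f :+ p :* f := l :+ (p :+ r) :* f) refl (∑ L) (q ^ a) P F₀ ⟩
    ∑ L + (P + q ^ a) * F₀                            ≡⟨ cong (λ l → ∑ L + l * F₀) (length-points a) ⟨
    ∑ L + length (points (suc a)) * F₀                ∎
    where
    open ≡-Reasoning
    open +-*-Solver
    F₀ P A : ℕ
    F₀ = F 𝟎
    P  = length (points a)
    A  = sum (map (λ h → ∑ (λ c → F (𝟘 ∷ multiple h c))) (points a))
    onLine : Column (suc a) → ℕ
    onLine h = ∑ λ c → F (multiple h c)
    K L : Fin q → ℕ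
    K c = ∑ᵛ a λ u → F (c ∷ scale c u)
    L c = ∑ᵛ a λ w → F (c ∷ w)
    K𝟘 : K 𝟘 ≡ q ^ a * F₀
    K𝟘 = trans (∑ᵛ-cong a λ u → cong (λ w → F (𝟘 ∷ w)) (scale-𝟘 u)) (∑ᵛ-const q a F₀)
    split : sum (map onLine (map horizontal (points a) ++ map slope (allVertices q a))) ≡ A + ∑ K
    split = begin
      sum (map onLine (map horizontal (points a) ++ map slope (allVertices q a)))
        ≡⟨ cong sum (map-++ onLine (map horizontal (points a)) _) ⟩
      sum (map onLine (map horizontal (points a)) ++ map onLine (map slope (allVertices q a)))
        ≡⟨ sum-++ (map onLine (map horizontal (points a))) _ ⟩
      sum (map onLine (map horizontal (points a))) + sum (map onLine (map slope (allVertices q a)))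
        ≡⟨ cong₂ _+_ (cong sum (map-∘ (points a))) (cong sum (map-∘ (allVertices q a))) ⟨
      A + sum (map (onLine ∘ slope) (allVertices q a))
        ≡⟨ cong (A +_) (trans (sum-allVertices q a _) (∑ᵛ-∑ a λ u c → F (c ∷ scale c u))) ⟩
      A + ∑ K ∎

  syndrome : ∀ {a} (hs : List (Column a)) → Vertex q (length hs) → Vertex q a
  syndrome []       []      = 𝟎
  syndrome (h ∷ hs) (x ∷ u) = multiple h x ⊕ syndrome hs u

  lineSum : ∀ {a} → (Vertex q a → ℕ) → Vertex q a → Column a → ℕ
  lineSum F g h = ∑ λ c → F (g ⊕ multiple h c)

  -- Changing one coordinate of v moves its syndrome g along the line through g in the direction of
  -- that column. Each line contains g itself, so the line sums count F g once too often per column;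
  -- the left side compensates for this.
  ∑-ball-syndrome : ∀ {a} (hs : List (Column a)) F v → let g = syndrome hs v in
    ∑-ball (length hs) 1 (F ∘ syndrome hs) v + length hs * F g ≡ F g + sum (map (lineSum F g) hs)
  ∑-ball-syndrome []       F []      = refl
  ∑-ball-syndrome (h ∷ hs) F (y ∷ v) = begin
    B + (F g + n * F g)                                    ≡⟨ +-assoc B (F g) (n * F g) ⟨
    B + F g + n * F g                                      ≡⟨ cong (_+ n * F g) (∑-ball-1-∷ n (F ∘ syndrome (h ∷ hs)) y v) ⟩
    ∑ (λ x → F (multiple h x ⊕ s)) + B′ + n * F g          ≡⟨ cong (λ l → l + B′ + n * F g) line ⟩
    lineSum F g h + B′ + n * F g                           ≡⟨ +-assoc (lineSum F g h) B′ (n * F g) ⟩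
    lineSum F g h + (B′ + n * F g)                         ≡⟨ cong (lineSum F g h +_) (∑-ball-syndrome hs F′ v) ⟩
    lineSum F g h + (F g + sum (map (lineSum F′ s) hs))    ≡⟨ cong (λ l → lineSum F g h + (F g + l)) (cong sum (map-cong lines hs)) ⟩
    lineSum F g h + (F g + sum (map (lineSum F g) hs))     ≡⟨ solve 3 (λ x y z → x :+ (y :+ z) := y :+ (x :+ z)) refl
                                                                (lineSum F g h) (F g) (sum (map (lineSum F g) hs)) ⟩
    F g + (lineSum F g h + sum (map (lineSum F g) hs))     ∎
    where
    open ≡-Reasoning
    open +-*-Solver
    n = length hs
    s = syndrome hs v
    g = multiple h y ⊕ s
    -- Absorbing the first column's contribution into the function lets the induction hypothesis
    -- apply to the remaining columns.
    F′ = λ w → F (multiple h y ⊕ w)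
    B = ∑-ball (suc n) 1 (F ∘ syndrome (h ∷ hs)) (y ∷ v)
    B′ = ∑-ball n 1 (F′ ∘ syndrome hs) v
    lines : ∀ h′ → lineSum F′ s h′ ≡ lineSum F g h′
    lines h′ = sum-cong-≗ {q} λ c → cong F (sym (⊕-assoc (multiple h y) s (multiple h′ c)))
    line : ∑ (λ x → F (multiple h x ⊕ s)) ≡ lineSum F g h
    -- Substituting y ⊞ c for x bases the line at g instead of at the syndrome of the tail.
    line = trans (sym (∑-reindex (y ⊞_) (⊞-cancel y) (λ x → F (multiple h x ⊕ s)))) (sum-cong-≗ {q} λ c → cong F (begin
      multiple h (y ⊞ c) ⊕ s                     ≡⟨ cong (_⊕ s) (additive h y c) ⟩
      multiple h y ⊕ multiple h c ⊕ s            ≡⟨ ⊕-assoc (multiple h y) (multiple h c) s ⟩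
      multiple h y ⊕ (multiple h c ⊕ s)          ≡⟨ cong (multiple h y ⊕_) (⊕-comm (multiple h c) s) ⟩
      multiple h y ⊕ (s ⊕ multiple h c)          ≡⟨ ⊕-assoc (multiple h y) s (multiple h c) ⟨
      multiple h y ⊕ s ⊕ multiple h c            ∎))

-- Repeated columns and zero columns.

sum-map-copies : ∀ {A : Set} (f : A → ℕ) m xs → sum (map f (concat (replicate m xs))) ≡ m * sum (map f xs)
sum-map-copies f zero    xs = refl
sum-map-copies f (suc m) xs = trans (cong sum (map-++ f xs _))
  (trans (sum-++ (map f xs) _) (cong (sum (map f xs) +_) (sum-map-copies f m xs)))

length-copies : ∀ {A : Set} m (xs : List A) → length (concat (replicate m xs)) ≡ m * length xs
length-copies zero    xs = refl
length-copies (suc m) xs = trans (length-++ xs) (cong (length xs +_) (length-copies m xs))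

sum-map-replicate : ∀ {A : Set} (f : A → ℕ) n x → sum (map f (replicate n x)) ≡ n * f x
sum-map-replicate f zero    x = refl
sum-map-replicate f (suc n) x = cong (f x +_) (sum-map-replicate f n x)

module HammingCodes {q : ℕ} (𝔽 : Prequasifield (suc q)) where
  open LinearCodes 𝔽

  points-count : ∀ a → q * length (points a) + 1 ≡ suc q ^ a
  points-count zero    = solve 1 (λ q → q :* con 0 :+ con 1 := con 1) refl q
    where open +-*-Solver
  points-count (suc a) = begin
    q * length (points (suc a)) + 1                ≡⟨ cong (λ l → q * l + 1) (length-points a) ⟩
    q * (P + Q) + 1                                ≡⟨ solve 3 (λ q P Q → q :* (P :+ Q) :+ con 1 := (q :* P :+ con 1) :+ q :* Q) refl q P Q ⟩
    (q * P + 1) + q * Q                            ≡⟨ cong (_+ q * Q) (points-count a) ⟩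
    Q + q * Q                                      ∎
    where
    open ≡-Reasoning
    open +-*-Solver
    P = length (points a)
    Q = suc q ^ a

  columns : ∀ (z m a : ℕ) → List (Column a)
  columns z m a = replicate z zeroColumn ++ concat (replicate m (points a))

  length-columns : ∀ z m a → length (columns z m a) ≡ z + m * length (points a)
  length-columns z m a = trans (length-++ (replicate z zeroColumn))
    (cong₂ _+_ (length-replicate z) (length-copies m (points a)))

  -- A zero column sums to (q + 1) F g, a surplus of q F g over the compensating term. The z
  -- surpluses and F g itself make (q z + 1) F g = m F g, exactly what m copies of `sum-points`
  -- require.
  ∑-ball-columns : ∀ z a F v → let m = q * z + 1 ; hs = columns z m a in
    ∑-ball (length hs) 1 (F ∘ syndrome hs) v ≡ m * ∑ᵛ a F
  ∑-ball-columns z a F v = +-cancelʳ-≡ (z * f + m * P * f + m * f) B (m * T) (begin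
    B + (z * f + m * P * f + m * f)                  ≡⟨ solve 5 (λ B z mP m f → B :+ (z :* f :+ mP :* f :+ m :* f) := B :+ (z :+ mP) :* f :+ m :* f)
                                                          refl B z (m * P) m f ⟩
    B + (z + m * P) * f + m * f                      ≡⟨ cong (λ l → B + l * f + m * f) (length-columns z m a) ⟨
    B + length hs * f + m * f                        ≡⟨ cong (_+ m * f) (∑-ball-syndrome hs F v) ⟩
    f + sum (map (lineSum F g) hs) + m * f           ≡⟨ cong (λ l → f + l + m * f) lines ⟩
    f + (z * (suc q * f) + m * S) + m * f            ≡⟨ solve 5 (λ f z q m S → f :+ (z :* ((con 1 :+ q) :* f) :+ m :* S) :+ m :* f
                                                          := f :+ z :* ((con 1 :+ q) :* f) :+ m :* (f :+ S)) refl f z q m S ⟩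
    f + z * (suc q * f) + m * (f + S)                ≡⟨ cong (λ l → f + z * (suc q * f) + m * l) balance ⟩
    f + z * (suc q * f) + m * (T + P * f)            ≡⟨ solve 5 (λ f z q T P → let m = q :* z :+ con 1 in
                                                          f :+ z :* ((con 1 :+ q) :* f) :+ m :* (T :+ P :* f)
                                                          := m :* T :+ (z :* f :+ m :* P :* f :+ m :* f)) refl f z q T P ⟩
    m * T + (z * f + m * P * f + m * f)              ∎)
    where
    open ≡-Reasoning
    open +-*-Solver
    m = q * z + 1
    hs = columns z m a
    P = length (points a)
    g = syndrome hs v
    f = F g
    T = ∑ᵛ a F
    B = ∑-ball (length hs) 1 (F ∘ syndrome hs) v
    S = sum (map (lineSum F g) (points a))
    lines : sum (map (lineSum F g) hs) ≡ z * (suc q * f) + m * S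
    lines = begin
      sum (map (lineSum F g) hs)
        ≡⟨ cong sum (map-++ (lineSum F g) (replicate z zeroColumn) _) ⟩
      sum (map (lineSum F g) (replicate z zeroColumn) ++ map (lineSum F g) (concat (replicate m (points a))))
        ≡⟨ sum-++ (map (lineSum F g) (replicate z zeroColumn)) _ ⟩
      sum (map (lineSum F g) (replicate z zeroColumn)) + sum (map (lineSum F g) (concat (replicate m (points a))))
        ≡⟨ cong₂ _+_ (sum-map-replicate (lineSum F g) z zeroColumn) (sum-map-copies (lineSum F g) m (points a)) ⟩
      z * lineSum F g zeroColumn + m * S
        ≡⟨ cong (λ l → z * l + m * S) (trans (sum-cong-≗ {suc q} λ c → cong F (⊕-identityʳ g)) (∑-const (suc q) f)) ⟩
      z * (suc q * f) + m * S ∎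
    balance : f + S ≡ T + P * f
    balance = begin
      f + S                                             ≡⟨ cong (λ w → F w + S) (⊕-identityʳ g) ⟨
      F (g ⊕ 𝟎) + S                                     ≡⟨ sum-points a (λ w → F (g ⊕ w)) ⟩
      ∑ᵛ a (λ w → F (g ⊕ w)) + P * F (g ⊕ 𝟎)            ≡⟨ cong₂ (λ t w → t + P * F w) (∑ᵛ-translate g F) (⊕-identityʳ g) ⟩
      T + P * f                                         ∎

-- Functions with values 0 and 1 and a prescribed total.

distribute : ∀ n B t → t ≤ n * B → Σ (Fin n → ℕ) λ ts → (∀ i → ts i ≤ B) × ∑ ts ≡ t
distribute zero    B t t≤0 = (λ ()) , (λ ()) , sym (≤-antisym t≤0 z≤n)
distribute (suc n) B t t≤  with distribute n B (t ∸ B) (m≤n+o⇒m∸n≤o t B t≤)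
... | ts , ts≤B , ∑ts = (λ { zero → B ⊓ t ; (suc i) → ts i })
                      , (λ { zero → m⊓n≤m B t ; (suc i) → ts≤B i })
                      , trans (cong (B ⊓ t +_) ∑ts) (m⊓n+n∸m≡n B t)

-- Each of the q layers has room for q^a ones, so t is shared out greedily among the layers and each
-- share is placed recursively.
indicator : ∀ q a t → t ≤ q ^ a → Σ (Vertex q a → ℕ) λ F → (∀ w → F w ≤ 1) × ∑ᵛ a F ≡ t
indicator q zero    t t≤1 = (λ _ → t) , (λ _ → t≤1) , refl
indicator q (suc a) t t≤  with distribute q (q ^ a) t t≤
... | ts , ts≤ , ∑ts = (λ { (x ∷ w) → proj₁ (rec x) w })
                     , (λ { (x ∷ w) → proj₁ (proj₂ (rec x)) w })
                     , trans (sum-cong-≗ {q} λ x → proj₂ (proj₂ (rec x))) ∑ts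
  where
  rec : ∀ x → Σ (Vertex q a → ℕ) λ F → (∀ w → F w ≤ 1) × ∑ᵛ a F ≡ ts x
  rec x = indicator q a (ts x) (ts≤ x)

-- Exhaustive search for a dominating function.

Searchable : Set → Set₁
Searchable A = ∀ {P : A → Set} → (∀ x → Dec (P x)) → Dec (∃ P)

search-Vec : ∀ {A} → Searchable A → ∀ n → Searchable (Vec A n)
search-Vec search zero    P? = map′ (λ h → [] , h) (λ { ([] , h) → h }) (P? [])
search-Vec search (suc n) P? = map′ (λ (x , xs , h) → x ∷ xs , h) (λ { (x ∷ xs , h) → x , xs , h })
  (search λ x → search-Vec search n λ xs → P? (x ∷ xs))

search-∀ : ∀ {A} → Searchable A → ∀ {P : A → Set} → (∀ x → Dec (P x)) → Dec (∀ x → P x)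
search-∀ search P? = map′ (λ none x → decidable-stable (P? x) λ ¬Px → none (x , ¬Px)) (λ all (x , ¬Px) → ¬Px (all x))
  (¬? (search λ x → ¬? (P? x)))

-- A function on the vertices with values 0 and 1, stored as nested vectors, because the search runs
-- over finite data rather than over functions.
Table : ℕ → ℕ → Set
Table q zero    = Fin 2
Table q (suc d) = Vec (Table q d) q

search-Table : ∀ q d → Searchable (Table q d)
search-Table q zero    = any?
search-Table q (suc d) = search-Vec (search-Table q d) q

read : ∀ {q} d → Table q d → Vertex q d → Fin 2
read zero    T []      = T
read (suc d) T (x ∷ u) = read d (lookup T x) u

write : ∀ {q} d → (Vertex q d → Fin 2) → Table q d
write zero    f = f []
write (suc d) f = Vec.tabulate λ x → write d λ u → f (x ∷ u)

read-write : ∀ {q} d (f : Vertex q d → Fin 2) u → read d (write d f) u ≡ f u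
read-write zero    f []      = refl
read-write (suc d) f (x ∷ u) = trans (cong (λ T → read d T u) (lookup∘tabulate _ x)) (read-write d (λ u → f (x ∷ u)) u)

-- There are finitely many tables and finitely many conditions to test on each, so existence is
-- decidable and hence stable under double negation. This discharges the non-effective choice of
-- roots.
HasEfficientDominating-stable : ∀ q d k → ¬ ¬ HasEfficientDominating q d 1 k → HasEfficientDominating q d 1 k
HasEfficientDominating-stable q d k ¬¬has =
  let T , exact = decidable-stable search (λ none → ¬¬has λ (f , f≤1 , exact) → none (tableOf f f≤1 exact))
  in toℕ ∘ read d T , (λ u → s≤s⁻¹ (toℕ<n (read d T u))) , exact
  where
  Exact : Table q d → Set
  Exact T = ∀ v → sumClosedNbhd q d (toℕ ∘ read d T) v ≡ k
  search : Dec (∃ Exact)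
  search = search-Table q d λ T → search-∀ (search-Vec any? d) λ v → sumClosedNbhd q d (toℕ ∘ read d T) v ≟ k
  tableOf : ∀ f → (∀ u → f u ≤ 1) → (∀ v → sumClosedNbhd q d f v ≡ k) → ∃ Exact
  tableOf f f≤1 exact = write d digit , λ v → trans (cong sum (map-cong same (closedNbhd q d v))) (exact v)
    where
    digit : Vertex q d → Fin 2
    digit u = fromℕ< (s≤s (f≤1 u))
    same : ∀ u → toℕ (read d (write d digit) u) ≡ f u
    same u = trans (cong toℕ (read-write d digit u)) (toℕ-fromℕ< (s≤s (f≤1 u)))

-- Matching the parameters, and the two directions of the theorem.

zeroColumns : ∀ q P {d m} .{{_ : NonZero q}} → 1 ≤ m → q * d + 1 ≡ (q * P + 1) * m →
              ∃ λ z → d ≡ z + m * P × m ≡ q * z + 1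
zeroColumns q P {d} {m} 1≤m eq = z , sym d≡ , sym m≡
  where
  open +-*-Solver
  -- Expanded, the hypothesis says q (d - m P) = m - 1. Hence the d - m P coordinates left over by
  -- the m copies number (m - 1) / q, and 1 ≤ m keeps the difference nonnegative.
  eq′ : q * d + 1 ≡ m + q * (m * P)
  eq′ = trans eq (solve 3 (λ q P m → (q :* P :+ con 1) :* m := m :+ q :* (m :* P)) refl q P m)
  mP≤d : m * P ≤ d
  mP≤d = *-cancelˡ-≤ q (+-cancelʳ-≤ 1 _ _ (begin
    q * (m * P) + 1    ≤⟨ +-monoʳ-≤ (q * (m * P)) 1≤m ⟩
    q * (m * P) + m    ≡⟨ solve 2 (λ x y → x :+ y := y :+ x) refl (q * (m * P)) m ⟩
    m + q * (m * P)    ≡⟨ eq′ ⟨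
    q * d + 1          ∎))
    where open ≤-Reasoning
  z = d ∸ m * P
  d≡ : z + m * P ≡ d
  d≡ = trans (solve 2 (λ x y → x :+ y := y :+ x) refl z (m * P)) (m+[n∸m]≡n mP≤d)
  m≡ : q * z + 1 ≡ m
  m≡ = +-cancelʳ-≡ (q * (m * P)) _ _ (begin
    q * z + 1 + q * (m * P)    ≡⟨ solve 3 (λ q z x → q :* z :+ con 1 :+ q :* x := q :* (z :+ x) :+ con 1) refl q z (m * P) ⟩
    q * (z + m * P) + 1        ≡⟨ cong (λ d → q * d + 1) d≡ ⟩
    q * d + 1                  ≡⟨ eq′ ⟩
    m + q * (m * P)            ∎)
    where open ≡-Reasoning

prequasifield⇒dominating : ∀ {q} .{{_ : NonZero q}} → Prequasifield (suc q) → ∀ {d a m t} → 1 ≤ m →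
  q * d + 1 ≡ suc q ^ a * m → t ≤ suc q ^ a → HasEfficientDominating (suc q) d 1 (t * m)
prequasifield⇒dominating {q} 𝔽 {d} {a} {m} {t} 1≤m eq t≤
  with zeroColumns q (length (LinearCodes.points 𝔽 a)) 1≤m (trans eq (cong (_* m) (sym (HammingCodes.points-count 𝔽 a))))
     | indicator (suc q) a t t≤
... | z , d≡ , refl | F , F≤1 , ∑F =
  -- The code has as many coordinates as columns, and this number is only provably equal to d.
  subst (λ d → HasEfficientDominating (suc q) d 1 (t * m)) (trans (length-columns z m a) (sym d≡))
    ( F ∘ syndrome hs
    , (λ u → F≤1 (syndrome hs u))
    , λ v → begin
        sumClosedNbhd (suc q) (length hs) (F ∘ syndrome hs) v  ≡⟨ sumClosedNbhd≡∑-ball (suc q) (length hs) _ v ⟩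
        ∑-ball (length hs) 1 (F ∘ syndrome hs) v               ≡⟨ ∑-ball-columns z a F v ⟩
        m * ∑ᵛ a F                                             ≡⟨ cong (m *_) ∑F ⟩
        m * t                                                  ≡⟨ *-comm m t ⟩
        t * m                                                  ∎
    )
  where
  open ≡-Reasoning
  open LinearCodes 𝔽
  open HammingCodes 𝔽
  hs = columns z m a

1<primePower : ∀ {p} → Prime p → ∀ e → 2 ≤ p ^ suc e
1<primePower {p} pr e with p ^ suc e in eq
... | suc (suc _) = s≤s (s≤s z≤n)
... | 1 = ⊥-elim (¬prime[1] (subst Prime (m*n≡1⇒m≡1 p (p ^ e) eq) pr))
... | 0 = ⊥-elim (¬prime[0] (subst Prime (m^n≡0⇒m≡0 p (suc e) eq) pr))

-- Summing f(N[v]) = k over all v exhibits m as a divisor of (q + 1)^d k. Being coprime to q + 1, it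
-- survives the removal of the d factors one at a time.
dominating⇒∣ : ∀ {q d a m k} → Coprime m (suc q) → q * d + 1 ≡ suc q ^ a * m →
               HasEfficientDominating (suc q) d 1 k → m ∣ k
dominating⇒∣ {q} {d} {a} {m} {k} coprime eq (f , _ , exact) = cancel d (divides (suc q ^ a * ∑ᵛ d f) (begin
  suc q ^ d * k                          ≡⟨ ∑ᵛ-const (suc q) d k ⟨
  ∑ᵛ {suc q} d (λ _ → k)                 ≡⟨ ∑ᵛ-cong d (λ v → trans (sym (exact v)) (sumClosedNbhd≡∑-ball (suc q) d f v)) ⟩
  ∑ᵛ d (∑-ball d 1 f)                    ≡⟨ ∑ᵛ-∑-ball d f ⟩
  (q * d + 1) * ∑ᵛ d f                   ≡⟨ cong (_* ∑ᵛ d f) eq ⟩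
  suc q ^ a * m * ∑ᵛ d f                 ≡⟨ solve 3 (λ x m w → x :* m :* w := x :* w :* m) refl (suc q ^ a) m (∑ᵛ d f) ⟩
  suc q ^ a * ∑ᵛ d f * m                 ∎))
  where
  open ≡-Reasoning
  open +-*-Solver
  cancel : ∀ d → m ∣ suc q ^ d * k → m ∣ k
  cancel zero    h = subst (m ∣_) (solve 1 (λ k → con 1 :* k := k) refl k) h
  cancel (suc d) h = cancel d (coprime-divisor coprime (subst (m ∣_) (*-assoc (suc q) (suc q ^ d) k) h))

prime∤⇒coprime : ∀ {q m} → Prime q → ¬ (q ∣ m) → Coprime m q
prime∤⇒coprime pr q∤m (e∣m , e∣q) with prime⇒irreducible pr e∣q
... | inj₁ e≡1 = e≡1
... | inj₂ refl = ⊥-elim (q∤m e∣m)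

theorem6p1 : (q d a m : ℕ) → IsPrimePower q → 1 ≤ d → 1 ≤ m → ¬ (q ∣ m)
    → (q ∸ 1) * d + 1 ≡ q ^ a * m
    → ((k : ℕ) → 1 ≤ k → k ≤ (q ∸ 1) * d + 1 → m ∣ k → HasEfficientDominating q d 1 k)
    × (Prime q → (k : ℕ) → 1 ≤ k → k ≤ (q ∸ 1) * d + 1
    → (HasEfficientDominating q d 1 k ⇔ m ∣ k))
-- A prime power is at least 2, which excludes q = 0 and q = 1 and leaves q = n + 2.
theorem6p1 zero _ _ _ (_ , suc e , pr , _ , q≡) _ _ _ _ with subst (2 ≤_) (sym q≡) (1<primePower pr e)
... | ()
theorem6p1 (suc zero) _ _ _ (_ , suc e , pr , _ , q≡) _ _ _ _ with subst (2 ≤_) (sym q≡) (1<primePower pr e)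
... | s≤s ()
theorem6p1 q@(suc (suc n)) d a m (p , suc e , pr , _ , q≡) _ 1≤m q∤m eq =
  exists , λ prime-q k 1≤k k≤ → mk⇔ (dominating⇒∣ {a = a} (prime∤⇒coprime prime-q q∤m) eq) (exists k 1≤k k≤)
  where
  exists : (k : ℕ) → 1 ≤ k → k ≤ suc n * d + 1 → m ∣ k → HasEfficientDominating q d 1 k
  exists k _ k≤ (divides t refl) = HasEfficientDominating-stable q d (t * m) λ none →
    FixedPoints.¬¬prequasifield {e = e} pr q≡ (splitX^q-X pr n) λ 𝔽 →
    -- Cancelling m in t m ≤ q^a m gives t ≤ q^a, so 𝔽^a has room for t chosen syndromes.
    none (prequasifield⇒dominating 𝔽 {a = a} 1≤m eq (*-cancelʳ-≤ t _ m {{>-nonZero 1≤m}} (≤-trans k≤ (≤-reflexive eq))))
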